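{- Let $m,n\ge 1$ and $t>2$ be integers, and let $G_{m,n}$ be the $m\times n$ grid graph. Then \[\gamma_{t,2}(G_{m,n}) \ge \frac{mn}{2(t-1)^2}.\]
   Context: The $m\times n$ grid graph $G_{m,n}$ has vertex set $\{(i,j)\in\mathbb{Z}^2: 0\le i<m,\ 0\le j<n\}$, with two vertices adjacent iff they differ by 1 in exactly one coordinate. For a graph $G=(V,E)$ and positive integers $t,r$, a tower vertex $T\in V$ supplies to a vertex $v\in V$ the signal $sig(T,v)=\max(t-dist(T,v),0)$, where $dist$ is the graph (shortest-path) distance. A $(t,r)$ broadcast on $G$ is a set $\mathbb{T}\subseteq V$ such that for every $v\in V$, $\sum_{T\in\mathbb{T}} sig(T,v)\ge r$. The $(t,r)$ broadcast domination number $\gamma_{t,r}(G)$ is the minimum cardinality of a $(t,r)$ broadcast on $G$. -}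

module Defs where

open import Data.Nat using (ℕ; zero; suc; _+_; _∸_; _≤_; ∣_-_∣)
open import Data.Fin using (Fin; toℕ)
open import Data.Product using (_×_)
open import Data.Sum using (_⊎_)
open import Data.List using (List; []; _∷_)
open import Relation.Binary.PropositionalEquality using (_≡_)

GridV : ℕ → ℕ → Set
GridV m n = Fin m × Fin n

GridAdj : ∀ {m n} → GridV m n → GridV m n → Set
GridAdj (i Data.Product., j) (i' Data.Product., j') =
  (i ≡ i' × ∣ toℕ j - toℕ j' ∣ ≡ 1) ⊎ (j ≡ j' × ∣ toℕ i - toℕ i' ∣ ≡ 1)

data Walk {m n : ℕ} : ℕ → GridV m n → GridV m n → Set where
  here : ∀ {u} → Walk zero u u
  step : ∀ {k u w v} → Walk k u w → GridAdj w v → Walk (suc k) u v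

IsGridDist : ∀ {m n} → (GridV m n → GridV m n → ℕ) → Set
IsGridDist {m} {n} d =
  ∀ (u v : GridV m n) → Walk (d u v) u v × (∀ k → Walk k u v → d u v ≤ k)

sig : ∀ {m n} → (GridV m n → GridV m n → ℕ) → ℕ → GridV m n → GridV m n → ℕ
sig d t T v = t ∸ d T v

totalSig : ∀ {m n} → (GridV m n → GridV m n → ℕ) → ℕ → List (GridV m n) → GridV m n → ℕ
totalSig d t [] v = 0
totalSig d t (T ∷ Ts) v = sig d t T v + totalSig d t Ts v

IsBroadcast : ∀ {m n} → (GridV m n → GridV m n → ℕ) → ℕ → ℕ → List (GridV m n) → Set
IsBroadcast {m} {n} d t r Ts = ∀ (v : GridV m n) → r ≤ totalSig d t Ts v

{-# OPTIONS --safe #-}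
module Submission where

-- Unfold the grid by reflections into a doubly periodic set of towers in ℤ², put s = t − 1, and call
-- the edge from v to v + (1 , 0) the cell at v. A cell is covered by a tower reaching both of its
-- ends; a tower covers 2s² cells and there are as many cells as vertices, so it suffices that cells
-- are covered at least once on average. Each end of an uncovered cell is at distance exactly s from
-- two towers on its own side. Only a few configurations allow this, and each forces a doubly covered
-- cell at a fixed displacement from the uncovered one. The displacements can be chosen so that no
-- cell serves two uncovered cells. (For s = 1 this fails: the towers x + y ≡ 0 mod 3 have density 1/3.)
-- In the coordinates x + y and x − y everything is linear with integer coefficients, s being one of
-- the variables, so that the case analysis is left to a verified decision procedure.

-- A vertex receives signal 2 from one tower within s - 1 or from two towers within s. A tower
-- within s - 1 of one end of a cell is within s of the other end, so at an uncovered cell only the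
-- second alternative remains. The count is a discharging: every uncovered cell sends one unit along
-- its displacement. A cell that receives a unit is covered twice, and no cell receives two, so 1 +
-- received ≤ covered + sent at every cell. The displacements being constant vectors, sent and
-- received agree when summed over a period, and no matching of cells has to be built. The obstacle
-- is that several configurations may occur at one cell, and a careless choice lets two cells aim at
-- the same target. Hence an order of precedence: a configuration records in `absent` the patterns
-- that are preferred to it, and a conflict is excluded because a tower of one cell covers the other
-- cell or because a pattern that must be absent appears. Reflection in the horizontal axis doubles
-- the list of configurations, but only the relative orientation of two cells matters, so two 9 × 9
-- tables suffice.

open import Defs

-- A verified decision procedure for linear integer arithmetic.

module LinearArithmetic where
  open import Data.Bool using (Bool; true; false; _∧_; _∨_; if_then_else_; T)
  open import Data.Bool.Properties using (T-≡)
  open import Data.Empty using (⊥; ⊥-elim)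
  open import Data.Integer using (ℤ; +_; -[1+_]; _+_; _*_; -_; _-_; _≤_; _<_; 0ℤ; 1ℤ)
  open import Data.Integer.DivMod using (_/ℕ_; _%ℕ_; a≡a%ℕn+[a/ℕn]*n; n%ℕd<d)
  import Data.Integer.Properties as ℤₚ
  open import Data.Integer.Solver using (module +-*-Solver)
  open import Data.Bool.ListAction using (any; all)
  open import Data.List using (List; []; _∷_; map; _++_; concatMap)
  open import Data.List.Properties using (≡-dec)
  open import Data.List.Relation.Unary.All using (All; []; _∷_)
  import Data.List.Relation.Unary.All.Properties as Allₚ
  open import Data.Nat using (ℕ; zero; suc)
  import Data.Nat as ℕ
  open import Data.Product using (_×_; _,_)
  open import Data.Sum using (_⊎_; inj₁; inj₂)
  open import Function using (_∘_)
  open import Function.Bundles using (Equivalence)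
  open import Relation.Binary.Definitions using (tri<; tri≈; tri>)
  open import Relation.Binary.PropositionalEquality using (_≡_; refl; sym; trans; cong; cong₂; subst)
  open import Relation.Nullary using (¬_; Dec; yes; no)
  open import Relation.Nullary.Decidable using (⌊_⌋; _×-dec_; _⊎-dec_; _→-dec_; decidable-stable)

  infixl 6 _⊕_ _⊝_
  infix 5 _≼_ _≐_
  infixl 6 _⊞_
  infixl 7 _⊡_
  infixr 4 _∧′_
  infixr 3 _∨′_
  infixr 2 _⇒′_

  Env : Set
  Env = ℕ → ℤ

  data Expr : Set where
    var     : ℕ → Expr
    lit     : ℤ → Expr
    _⊕_ _⊝_ : Expr → Expr → Expr
    ⊟_      : Expr → Expr

  data Formula : Set where
    ⊥′                : Formula
    _≼_ _≐_           : Expr → Expr → Formula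
    _∧′_ _∨′_ _⇒′_ : Formula → Formula → Formula

  ⟦_⟧ₑ : Expr → Env → ℤ
  ⟦ var i ⟧ₑ ρ = ρ i
  ⟦ lit c ⟧ₑ ρ = c
  ⟦ a ⊕ b ⟧ₑ ρ = ⟦ a ⟧ₑ ρ + ⟦ b ⟧ₑ ρ
  ⟦ a ⊝ b ⟧ₑ ρ = ⟦ a ⟧ₑ ρ - ⟦ b ⟧ₑ ρ
  ⟦ ⊟ a ⟧ₑ ρ = - ⟦ a ⟧ₑ ρ

  ⟦_⟧ : Formula → Env → Set
  ⟦ ⊥′ ⟧ ρ = ⊥
  ⟦ a ≼ b ⟧ ρ = ⟦ a ⟧ₑ ρ ≤ ⟦ b ⟧ₑ ρ
  ⟦ a ≐ b ⟧ ρ = ⟦ a ⟧ₑ ρ ≡ ⟦ b ⟧ₑ ρ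
  ⟦ φ ∧′ ψ ⟧ ρ = ⟦ φ ⟧ ρ × ⟦ ψ ⟧ ρ
  ⟦ φ ∨′ ψ ⟧ ρ = ⟦ φ ⟧ ρ ⊎ ⟦ ψ ⟧ ρ
  ⟦ φ ⇒′ ψ ⟧ ρ = ⟦ φ ⟧ ρ → ⟦ ψ ⟧ ρ

  decide : ∀ φ ρ → Dec (⟦ φ ⟧ ρ)
  decide ⊥′ ρ = no λ ()
  decide (a ≼ b) ρ = ⟦ a ⟧ₑ ρ ℤₚ.≤? ⟦ b ⟧ₑ ρ
  decide (a ≐ b) ρ = ⟦ a ⟧ₑ ρ ℤₚ.≟ ⟦ b ⟧ₑ ρ
  decide (φ ∧′ ψ) ρ = decide φ ρ ×-dec decide ψ ρ
  decide (φ ∨′ ψ) ρ = decide φ ρ ⊎-dec decide ψ ρ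
  decide (φ ⇒′ ψ) ρ = decide φ ρ →-dec decide ψ ρ

  Lin : Set
  Lin = ℤ × List ℤ

  -- The head coefficient belongs to variable 0, so dropping it means passing to `ρ ∘ suc`;
  -- elimination recurses in this form.
  dot : List ℤ → Env → ℤ
  dot [] ρ = 0ℤ
  dot (a ∷ as) ρ = a * ρ 0 + dot as (ρ ∘ suc)

  value : Lin → Env → ℤ
  value (c , as) ρ = c + dot as ρ

  addᶜ : List ℤ → List ℤ → List ℤ
  addᶜ [] bs = bs
  addᶜ as@(_ ∷ _) [] = as
  addᶜ (a ∷ as) (b ∷ bs) = a + b ∷ addᶜ as bs

  dot-add : ∀ as bs ρ → dot (addᶜ as bs) ρ ≡ dot as ρ + dot bs ρ
  dot-add [] bs ρ = sym (ℤₚ.+-identityˡ _)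
  dot-add (_ ∷ _) [] ρ = sym (ℤₚ.+-identityʳ _)
  dot-add (a ∷ as) (b ∷ bs) ρ =
    trans (cong (λ z → (a + b) * ρ 0 + z) (dot-add as bs (ρ ∘ suc)))
          (solve 5 (λ a b x p q → (a :+ b) :* x :+ (p :+ q) := (a :* x :+ p) :+ (b :* x :+ q))
                 refl a b (ρ 0) (dot as (ρ ∘ suc)) (dot bs (ρ ∘ suc)))
    where open +-*-Solver

  dot-scale : ∀ k as ρ → dot (map (k *_) as) ρ ≡ k * dot as ρ
  dot-scale k [] ρ = sym (ℤₚ.*-zeroʳ k)
  dot-scale k (a ∷ as) ρ =
    trans (cong (λ z → k * a * ρ 0 + z) (dot-scale k as (ρ ∘ suc)))
          (solve 4 (λ k a x p → k :* a :* x :+ k :* p := k :* (a :* x :+ p))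
                 refl k a (ρ 0) (dot as (ρ ∘ suc)))
    where open +-*-Solver

  _⊞_ : Lin → Lin → Lin
  (c , as) ⊞ (d , bs) = c + d , addᶜ as bs

  _⊡_ : ℤ → Lin → Lin
  k ⊡ (c , as) = k * c , map (k *_) as

  value-⊞ : ∀ p q ρ → value (p ⊞ q) ρ ≡ value p ρ + value q ρ
  value-⊞ (c , as) (d , bs) ρ =
    trans (cong (λ z → c + d + z) (dot-add as bs ρ))
          (solve 4 (λ c d p q → (c :+ d) :+ (p :+ q) := (c :+ p) :+ (d :+ q)) refl c d (dot as ρ) (dot bs ρ))
    where open +-*-Solver

  value-⊡ : ∀ k p ρ → value (k ⊡ p) ρ ≡ k * value p ρ
  value-⊡ k (c , as) ρ =
    trans (cong (λ z → k * c + z) (dot-scale k as ρ)) (sym (ℤₚ.*-distribˡ-+ k c (dot as ρ)))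

  unit : ℕ → List ℤ
  unit zero = 1ℤ ∷ []
  unit (suc i) = 0ℤ ∷ unit i

  dot-unit : ∀ i ρ → dot (unit i) ρ ≡ ρ i
  dot-unit zero ρ = trans (ℤₚ.+-identityʳ _) (ℤₚ.*-identityˡ _)
  dot-unit (suc i) ρ = trans (cong (_+ dot (unit i) (ρ ∘ suc)) (ℤₚ.*-zeroˡ (ρ 0)))
                             (trans (ℤₚ.+-identityˡ _) (dot-unit i (ρ ∘ suc)))

  lin : Expr → Lin
  lin (var i) = 0ℤ , unit i
  lin (lit c) = c , []
  lin (a ⊕ b) = lin a ⊞ lin b
  lin (a ⊝ b) = lin a ⊞ (-[1+ 0 ] ⊡ lin b)
  lin (⊟ a) = -[1+ 0 ] ⊡ lin a

  value-neg : ∀ p ρ → value (-[1+ 0 ] ⊡ p) ρ ≡ - value p ρ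
  value-neg p ρ = trans (value-⊡ -[1+ 0 ] p ρ) (ℤₚ.-1*i≡-i _)

  lin-value : ∀ e ρ → value (lin e) ρ ≡ ⟦ e ⟧ₑ ρ
  lin-value (var i) ρ = trans (ℤₚ.+-identityˡ _) (dot-unit i ρ)
  lin-value (lit c) ρ = ℤₚ.+-identityʳ c
  lin-value (a ⊕ b) ρ = trans (value-⊞ (lin a) (lin b) ρ) (cong₂ _+_ (lin-value a ρ) (lin-value b ρ))
  lin-value (a ⊝ b) ρ = trans (value-⊞ (lin a) (-[1+ 0 ] ⊡ lin b) ρ)
    (cong₂ _+_ (lin-value a ρ) (trans (value-neg (lin b) ρ) (cong -_ (lin-value b ρ))))
  lin-value (⊟ a) ρ = trans (value-neg (lin a) ρ) (cong -_ (lin-value a ρ))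

  Nonneg : Env → Lin → Set
  Nonneg ρ p = 0ℤ ≤ value p ρ

  halves : List ℤ → List ℤ
  halves = map (_/ℕ 2)

  -- Fourier–Motzkin elimination is complete over ℚ only; rounding constraints with even coefficients
  -- recovers the parity arguments that are needed here.
  tighten : Lin → Lin
  tighten (c , as) = if ⌊ ≡-dec ℤₚ._≟_ (map (+ 2 *_) (halves as)) as ⌋ then (c /ℕ 2 , halves as) else (c , as)

  -- If q + R were at most -1, the hypothesis would bound 0 by r - 2 < 0. So the constant of a
  -- constraint with even coefficients may be rounded down after halving.
  0≤halve : ∀ r q R → r ℕ.< 2 → 0ℤ ≤ (+ r + q * + 2) + + 2 * R → 0ℤ ≤ q + R
  0≤halve r q R r<2 h with 0ℤ ℤₚ.≤? q + R
  ... | yes p = p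
  ... | no ¬p = ⊥-elim (ℤₚ.<-irrefl refl (ℤₚ.≤-<-trans h (ℤₚ.≤-<-trans (ℤₚ.≤-reflexive eq) lt)))
    where
    open +-*-Solver
    eq : (+ r + q * + 2) + + 2 * R ≡ + r + (q + R) * + 2
    eq = solve 3 (λ r q R → (r :+ q :* con (+ 2)) :+ con (+ 2) :* R := r :+ (q :+ R) :* con (+ 2)) refl (+ r) q R
    q+R≤-1 : q + R ≤ -[1+ 0 ]
    q+R≤-1 = ℤₚ.i<j⇒i≤pred[j] (ℤₚ.≰⇒> ¬p)
    lt : + r + (q + R) * + 2 < 0ℤ
    lt = ℤₚ.+-mono-<-≤ {+ r} {+ 2} {(q + R) * + 2} { -[1+ 0 ] * + 2} (Data.Integer.+<+ r<2)
        (ℤₚ.*-monoʳ-≤-nonNeg (+ 2) q+R≤-1)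

  tighten-sound : ∀ ρ p → Nonneg ρ p → Nonneg ρ (tighten p)
  tighten-sound ρ (c , as) h with ≡-dec ℤₚ._≟_ (map (+ 2 *_) (halves as)) as
  ... | no _ = h
  ... | yes e = 0≤halve (c %ℕ 2) (c /ℕ 2) (dot (halves as) ρ) (n%ℕd<d c 2)
    (subst (0ℤ ≤_) (cong₂ _+_ (a≡a%ℕn+[a/ℕn]*n c 2)
      (trans (sym (cong (λ z → dot z ρ) e)) (dot-scale (+ 2) (halves as) ρ))) h)

  isZero : ℤ → Bool
  isZero (+ 0) = true
  isZero _ = false

  absurd? : Lin → Bool
  absurd? (-[1+ _ ] , as) = all isZero as
  absurd? (+ _ , as) = false

  ∧-true : ∀ {a b} → a ∧ b ≡ true → a ≡ true × b ≡ true
  ∧-true {true} {true} _ = refl , refl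

  ∨-true : ∀ {a b} → a ∨ b ≡ true → a ≡ true ⊎ b ≡ true
  ∨-true {true} _ = inj₁ refl
  ∨-true {false} e = inj₂ e

  dot-zero : ∀ as ρ → all isZero as ≡ true → dot as ρ ≡ 0ℤ
  dot-zero [] ρ e = refl
  dot-zero (+ 0 ∷ as) ρ e = trans (cong₂ _+_ (ℤₚ.*-zeroˡ (ρ 0)) (dot-zero as (ρ ∘ suc) e)) refl
  dot-zero (+ (suc _) ∷ as) ρ ()
  dot-zero (-[1+ _ ] ∷ as) ρ ()

  absurd-sound : ∀ ρ p → absurd? p ≡ true → ¬ Nonneg ρ p
  absurd-sound ρ (-[1+ n ] , as) e h with subst (0ℤ ≤_) (cong (λ z → -[1+ n ] + z) (dot-zero as ρ e)) h
  ... | ()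

  any-absurd-sound : ∀ ρ ps → any absurd? ps ≡ true → ¬ All (Nonneg ρ) ps
  any-absurd-sound ρ (p ∷ ps) e (h ∷ hs) with ∨-true {absurd? p} e
  ... | inj₁ e₁ = absurd-sound ρ p e₁ h
  ... | inj₂ e₂ = any-absurd-sound ρ ps e₂ hs

  -- Constraints sorted by the sign of the coefficient of the leading variable x:
  -- those without x, those of the form (n+1) x + p ≥ 0, and those of the form p ≥ (n+1) x.
  record Sorted : Set where
    constructor sorted
    field
      free       : List Lin
      lower upper : List (ℕ × Lin)
  open Sorted

  insert : Lin → Sorted → Sorted
  insert (c , []) (sorted z l u) = sorted ((c , []) ∷ z) l u
  insert (c , + 0 ∷ as) (sorted z l u) = sorted ((c , as) ∷ z) l u
  insert (c , + suc n ∷ as) (sorted z l u) = sorted z ((n , (c , as)) ∷ l) u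
  insert (c , -[1+ n ] ∷ as) (sorted z l u) = sorted z l ((n , (c , as)) ∷ u)

  sort : List Lin → Sorted
  sort [] = sorted [] [] []
  sort (p ∷ ps) = insert p (sort ps)

  record Sound (ρ : Env) (S : Sorted) : Set where
    constructor sound
    field
      free✓  : All (Nonneg (ρ ∘ suc)) (free S)
      lower✓ : All (λ (n , p) → 0ℤ ≤ + suc n * ρ 0 + value p (ρ ∘ suc)) (lower S)
      upper✓ : All (λ (n , p) → 0ℤ ≤ -[1+ n ] * ρ 0 + value p (ρ ∘ suc)) (upper S)
  open Sound

  pull : ∀ c a d → c + (a + d) ≡ a + (c + d)
  pull = solve 3 (λ c a d → c :+ (a :+ d) := a :+ (c :+ d)) refl
    where open +-*-Solver

  insert-sound : ∀ ρ p S → Nonneg ρ p → Sound ρ S → Sound ρ (insert p S)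
  insert-sound ρ (c , []) S h (sound z l u) = sound (h ∷ z) l u
  insert-sound ρ (c , + 0 ∷ as) S h (sound z l u) =
    sound (subst (0ℤ ≤_) (cong (_+_ c) (trans (cong (_+ dot as (ρ ∘ suc)) (ℤₚ.*-zeroˡ (ρ 0)))
        (ℤₚ.+-identityˡ _))) h ∷ z) l u
  insert-sound ρ (c , + suc n ∷ as) S h (sound z l u) =
    sound z (subst (0ℤ ≤_) (pull c (+ suc n * ρ 0) (dot as (ρ ∘ suc))) h ∷ l) u
  insert-sound ρ (c , -[1+ n ] ∷ as) S h (sound z l u) =
    sound z l (subst (0ℤ ≤_) (pull c (-[1+ n ] * ρ 0) (dot as (ρ ∘ suc))) h ∷ u)

  sort-sound : ∀ ρ ps → All (Nonneg ρ) ps → Sound ρ (sort ps)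
  sort-sound ρ [] [] = sound [] [] []
  sort-sound ρ (p ∷ ps) (h ∷ hs) = insert-sound ρ p (sort ps) h (sort-sound ρ ps hs)

  -- The lower and the upper constraint are cross-multiplied by each other's positive leading
  -- coefficient, so that x cancels.
  resolve : ℕ × Lin → ℕ × Lin → Lin
  resolve (m , p) (n , q) = tighten ((+ suc n ⊡ p) ⊞ (+ suc m ⊡ q))

  resolve-sound : ∀ ρ x m p n q → 0ℤ ≤ + suc m * x + value p ρ → 0ℤ ≤ -[1+ n ] * x + value q ρ →
    Nonneg ρ (resolve (m , p) (n , q))
  resolve-sound ρ x m p n q hp hq = tighten-sound ρ ((+ suc n ⊡ p) ⊞ (+ suc m ⊡ q))
    (subst (0ℤ ≤_) eq (ℤₚ.+-mono-≤ (scale n hp) (scale m hq)))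
    where
    open +-*-Solver
    scale : ∀ k {z} → 0ℤ ≤ z → 0ℤ ≤ + suc k * z
    scale k {z} h = subst (_≤ + suc k * z) (ℤₚ.*-zeroʳ (+ suc k)) (ℤₚ.*-monoˡ-≤-nonNeg (+ suc k) h)
    eq : + suc n * (+ suc m * x + value p ρ) + + suc m * (-[1+ n ] * x + value q ρ)
       ≡ value ((+ suc n ⊡ p) ⊞ (+ suc m ⊡ q)) ρ
    eq = trans (solve 5 (λ a b x p q → a :* (b :* x :+ p) :+ b :* (:- a :* x :+ q) := a :* p :+ b :* q)
                      refl (+ suc n) (+ suc m) x (value p ρ) (value q ρ))
               (sym (trans (value-⊞ (+ suc n ⊡ p) (+ suc m ⊡ q) ρ)
                           (cong₂ _+_ (value-⊡ (+ suc n) p ρ) (value-⊡ (+ suc m) q ρ))))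

  eliminate : Sorted → List Lin
  eliminate S = free S ++ concatMap (λ p → map (resolve p) (upper S)) (lower S)

  eliminate-sound : ∀ ρ S → Sound ρ S → All (Nonneg (ρ ∘ suc)) (eliminate S)
  eliminate-sound ρ S (sound z l u) = Allₚ.++⁺ z (rows (lower S) l)
    where
    row : ∀ m p us → 0ℤ ≤ + suc m * ρ 0 + value p (ρ ∘ suc) →
      All (λ (n , q) → 0ℤ ≤ -[1+ n ] * ρ 0 + value q (ρ ∘ suc)) us →
      All (Nonneg (ρ ∘ suc)) (map (resolve (m , p)) us)
    row m p [] h [] = []
    row m p ((n , q) ∷ us) h (k ∷ ks) = resolve-sound (ρ ∘ suc) (ρ 0) m p n q h k ∷ row m p us h ks
    rows : ∀ ls → All (λ (n , p) → 0ℤ ≤ + suc n * ρ 0 + value p (ρ ∘ suc)) ls →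
      All (Nonneg (ρ ∘ suc)) (concatMap (λ p → map (resolve p) (upper S)) ls)
    rows [] [] = []
    rows ((m , p) ∷ ls) (h ∷ hs) = Allₚ.++⁺ (row m p (upper S) h u) (rows ls hs)

  infeasible : ℕ → List Lin → Bool
  infeasible zero ps = any absurd? ps
  infeasible (suc n) ps = any absurd? ps ∨ infeasible n (eliminate (sort ps))

  infeasible-sound : ∀ n ρ ps → infeasible n ps ≡ true → ¬ All (Nonneg ρ) ps
  infeasible-sound zero ρ ps e = any-absurd-sound ρ ps e
  infeasible-sound (suc n) ρ ps e hs with ∨-true {any absurd? ps} e
  ... | inj₁ e₁ = any-absurd-sound ρ ps e₁ hs
  ... | inj₂ e₂ = infeasible-sound n (ρ ∘ suc) _ e₂ (eliminate-sound ρ (sort ps) (sort-sound ρ ps hs))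

  _≥′_ _<′_ : Expr → Expr → Lin
  a ≥′ b = lin (a ⊝ b)
  a <′ b = lin (b ⊝ (lit 1ℤ ⊕ a))

  ≥′-sound : ∀ ρ a b → ⟦ b ⟧ₑ ρ ≤ ⟦ a ⟧ₑ ρ → Nonneg ρ (a ≥′ b)
  ≥′-sound ρ a b h = subst (0ℤ ≤_) (sym (lin-value (a ⊝ b) ρ)) (ℤₚ.i≤j⇒0≤j-i h)

  <′-sound : ∀ ρ a b → ⟦ a ⟧ₑ ρ < ⟦ b ⟧ₑ ρ → Nonneg ρ (a <′ b)
  <′-sound ρ a b h = ≥′-sound ρ b (lit 1ℤ ⊕ a) (ℤₚ.i<j⇒suc[i]≤j h)

  Holds : Bool → Formula → Env → Set
  Holds true φ ρ = ⟦ φ ⟧ ρ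
  Holds false φ ρ = ¬ ⟦ φ ⟧ ρ

  Refutes : Env → (List Lin → Bool) → Set
  Refutes ρ k = ∀ cs → k cs ≡ true → ¬ All (Nonneg ρ) cs

  -- Reduction of formulas to systems of linear constraints.

  module Tableau (fuel : ℕ) where

    closed? : List Lin → Bool
    closed? = infeasible fuel

    -- A tableau: it assumes φ (or its negation, according to the first argument),
    -- splits on disjunctions, and passes each branch of linear constraints to the continuation.
    branch : Bool → Formula → (List Lin → Bool) → List Lin → Bool
    branch true ⊥′ k cs = true
    branch false ⊥′ k cs = k cs
    branch true (a ≼ b) k cs = k (b ≥′ a ∷ cs)
    branch false (a ≼ b) k cs = k (b <′ a ∷ cs)
    branch true (a ≐ b) k cs = k (b ≥′ a ∷ a ≥′ b ∷ cs)
    -- Over ℤ, a ≠ b is a split into two strict inequalities. As at every split, the constraints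
    -- collected so far are tested first, which prunes the tree.
    branch false (a ≐ b) k cs = closed? cs ∨ (k (a <′ b ∷ cs) ∧ k (b <′ a ∷ cs))
    branch true (φ ∧′ ψ) k cs = branch true φ (branch true ψ k) cs
    branch false (φ ∧′ ψ) k cs = closed? cs ∨ (branch false φ k cs ∧ branch false ψ k cs)
    branch true (φ ∨′ ψ) k cs = closed? cs ∨ (branch true φ k cs ∧ branch true ψ k cs)
    branch false (φ ∨′ ψ) k cs = branch false φ (branch false ψ k) cs
    branch true (φ ⇒′ ψ) k cs = closed? cs ∨ (branch false φ k cs ∧ branch true ψ k cs)
    branch false (φ ⇒′ ψ) k cs = branch true φ (branch false ψ k) cs

    split : ∀ {ρ cs a b} {A B : Set} → (a ≡ true → ¬ A) → (b ≡ true → ¬ B) →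
      closed? cs ∨ (a ∧ b) ≡ true → A ⊎ B → ¬ All (Nonneg ρ) cs
    split {ρ} {cs} {a} f g e h hs with ∨-true {closed? cs} e
    ... | inj₁ e₁ = infeasible-sound fuel ρ cs e₁ hs
    ... | inj₂ e₂ with ∧-true {a} e₂ | h
    ...   | e₃ , _ | inj₁ x = f e₃ x
    ...   | _ , e₄ | inj₂ y = g e₄ y

    branch-sound : ∀ ρ b φ k → Refutes ρ k → Holds b φ ρ → Refutes ρ (branch b φ k)
    branch-sound ρ true ⊥′ k r h cs e hs = h
    branch-sound ρ false ⊥′ k r h cs e hs = r cs e hs
    branch-sound ρ true (a ≼ b) k r h cs e hs = r _ e (≥′-sound ρ b a h ∷ hs)
    branch-sound ρ false (a ≼ b) k r h cs e hs = r _ e (<′-sound ρ b a (ℤₚ.≰⇒> h) ∷ hs)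
    branch-sound ρ true (a ≐ b) k r h cs e hs =
      r _ e (≥′-sound ρ b a (ℤₚ.≤-reflexive h) ∷ ≥′-sound ρ a b (ℤₚ.≤-reflexive (sym h)) ∷ hs)
    branch-sound ρ false (a ≐ b) k r h cs e hs =
      split (λ e₁ p → r _ e₁ (<′-sound ρ a b p ∷ hs)) (λ e₂ p → r _ e₂ (<′-sound ρ b a p ∷ hs)) e apart hs
      where
      apart : ⟦ a ⟧ₑ ρ < ⟦ b ⟧ₑ ρ ⊎ ⟦ b ⟧ₑ ρ < ⟦ a ⟧ₑ ρ
      apart with ℤₚ.<-cmp (⟦ a ⟧ₑ ρ) (⟦ b ⟧ₑ ρ)
      ... | tri< p _ _ = inj₁ p
      ... | tri≈ _ p _ = ⊥-elim (h p)
      ... | tri> _ _ p = inj₂ p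
    branch-sound ρ true (φ ∧′ ψ) k r (h , h′) = branch-sound ρ true φ _ (branch-sound ρ true ψ k r h′) h
    branch-sound ρ false (φ ∧′ ψ) k r h cs e hs =
      split (λ e₁ p → branch-sound ρ false φ k r p cs e₁ hs) (λ e₂ p → branch-sound ρ false ψ k r p cs e₂ hs) e fails hs
      where
      fails : ¬ ⟦ φ ⟧ ρ ⊎ ¬ ⟦ ψ ⟧ ρ
      fails with decide φ ρ
      ... | yes p = inj₂ λ q → h (p , q)
      ... | no ¬p = inj₁ ¬p
    branch-sound ρ true (φ ∨′ ψ) k r h cs e hs =
      split (λ e₁ p → branch-sound ρ true φ k r p cs e₁ hs) (λ e₂ p → branch-sound ρ true ψ k r p cs e₂ hs) e h hs
    branch-sound ρ false (φ ∨′ ψ) k r h = branch-sound ρ false φ _ (branch-sound ρ false ψ k r (h ∘ inj₂)) (h ∘ inj₁)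
    branch-sound ρ true (φ ⇒′ ψ) k r h cs e hs =
      split (λ e₁ p → branch-sound ρ false φ k r p cs e₁ hs) (λ e₂ p → branch-sound ρ true ψ k r p cs e₂ hs) e cases hs
      where
      cases : ¬ ⟦ φ ⟧ ρ ⊎ ⟦ ψ ⟧ ρ
      cases with decide φ ρ
      ... | yes p = inj₂ (h p)
      ... | no ¬p = inj₁ ¬p
    branch-sound ρ false (φ ⇒′ ψ) k r h with decide φ ρ
    ... | yes p = branch-sound ρ true φ _ (branch-sound ρ false ψ k r (λ q → h (λ _ → q))) p
    ... | no ¬p = ⊥-elim (h (⊥-elim ∘ ¬p))

  valid? : Formula → Bool
  valid? φ = branch false φ closed? []
    -- The number of variables that can be eliminated. The formulas decided below have at most
    -- eleven (`box`), so none is left over.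
    where open Tableau 13

  valid-sound : ∀ φ → valid? φ ≡ true → ∀ ρ → ⟦ φ ⟧ ρ
  valid-sound φ e ρ = decidable-stable (decide φ ρ)
    λ h → branch-sound ρ false φ (infeasible 13) (infeasible-sound 13 ρ) h [] e []
    where open Tableau 13

  env : List ℤ → Env
  env [] _ = 0ℤ
  env (x ∷ xs) zero = x
  env (x ∷ xs) (suc i) = env xs i

  -- Opaque, since unfolding a proof would rerun the tableau with open terms.
  opaque
    by : ∀ φ xs → {T (valid? φ)} → ⟦ φ ⟧ (env xs)
    by φ xs {e} = valid-sound φ (Equivalence.to T-≡ e) (env xs)

  subₑ : (ℕ → Expr) → Expr → Expr
  subₑ σ (var i) = σ i
  subₑ σ (lit c) = lit c
  subₑ σ (a ⊕ b) = subₑ σ a ⊕ subₑ σ b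
  subₑ σ (a ⊝ b) = subₑ σ a ⊝ subₑ σ b
  subₑ σ (⊟ a) = ⊟ subₑ σ a

  sub : (ℕ → Expr) → Formula → Formula
  sub σ ⊥′ = ⊥′
  sub σ (a ≼ b) = subₑ σ a ≼ subₑ σ b
  sub σ (a ≐ b) = subₑ σ a ≐ subₑ σ b
  sub σ (φ ∧′ ψ) = sub σ φ ∧′ sub σ ψ
  sub σ (φ ∨′ ψ) = sub σ φ ∨′ sub σ ψ
  sub σ (φ ⇒′ ψ) = sub σ φ ⇒′ sub σ ψ

  module _ {σ : ℕ → Expr} {ρ ρ′ : Env} (h : ∀ i → ⟦ σ i ⟧ₑ ρ ≡ ρ′ i) where
    subₑ-eval : ∀ e → ⟦ subₑ σ e ⟧ₑ ρ ≡ ⟦ e ⟧ₑ ρ′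
    subₑ-eval (var i) = h i
    subₑ-eval (lit c) = refl
    subₑ-eval (a ⊕ b) = cong₂ _+_ (subₑ-eval a) (subₑ-eval b)
    subₑ-eval (a ⊝ b) = cong₂ _-_ (subₑ-eval a) (subₑ-eval b)
    subₑ-eval (⊟ a) = cong -_ (subₑ-eval a)

    sub-eval : ∀ φ → ⟦ sub σ φ ⟧ ρ ≡ ⟦ φ ⟧ ρ′
    sub-eval ⊥′ = refl
    sub-eval (a ≼ b) = cong₂ _≤_ (subₑ-eval a) (subₑ-eval b)
    sub-eval (a ≐ b) = cong₂ _≡_ (subₑ-eval a) (subₑ-eval b)
    sub-eval (φ ∧′ ψ) = cong₂ _×_ (sub-eval φ) (sub-eval ψ)
    sub-eval (φ ∨′ ψ) = cong₂ _⊎_ (sub-eval φ) (sub-eval ψ)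
    sub-eval (φ ⇒′ ψ) = cong₂ (λ A B → A → B) (sub-eval φ) (sub-eval ψ)

-- The nine configurations and their mutual exclusion.

module Configurations where
  open LinearArithmetic
  open import Data.Bool using (Bool; true; false; _∨_; T)
  open import Data.Bool.Properties using (T?; T-≡)
  open import Data.Bool.ListAction using (any)
  open import Data.Empty using (⊥)
  open import Data.Fin using (Fin; zero; suc; toℕ)
  import Data.Fin.Properties as Finₚ
  open import Data.Integer using (ℤ; +_; -[1+_]; _+_; -_; _-_; _≤_; 0ℤ; 1ℤ)
  import Data.Integer.Properties as ℤₚ
  open import Data.List using (List; []; _∷_; map; _++_; foldr; lookup; drop)
  open import Data.List.Relation.Unary.All as All using (All; []; _∷_)
  import Data.List.Relation.Unary.All.Properties as Allₚ
  open import Data.Nat using (ℕ; zero; suc)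
  import Data.Nat as ℕ
  open import Data.Product using (_×_; _,_; proj₁; proj₂; ∃-syntax)
  open import Data.Product.Properties using () renaming (≡-dec to ×-≡-dec)
  open import Data.Sum using (inj₁; inj₂; [_,_]′)
  open import Function using (_∘_; id)
  open import Function.Bundles using (Equivalence)
  open import Relation.Binary.PropositionalEquality
  open import Relation.Nullary using (¬_; no)
  open import Relation.Nullary.Decidable using (⌊_⌋; toWitness)

  Point : Set
  Point = Expr × Expr

  Vector : Set
  Vector = ℤ × ℤ

  infixl 6 _⊹_ _−_
  infix 5 _≐ₚ_

  _⊹_ : Point → Vector → Point
  (x , y) ⊹ (a , b) = x ⊕ lit a , y ⊕ lit b

  _−_ : Vector → Vector → Vector
  (a , b) − (c , d) = a - c , b - d

  neg : Vector → Vector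
  neg (a , b) = - a , - b

  flip : Bool → Vector → Vector
  flip false v = v
  flip true (x , y) = x , - y

  flipₚ : Bool → Point → Point
  flipₚ false p = p
  flipₚ true (x , y) = x , ⊟ y

  -- Variable 0 is always the radius s = t − 1.
  s : Expr
  s = var 0

  p₁ p₂ : Point
  p₁ = var 1 , var 2
  p₂ = var 3 , var 4

  ¬′_ : Formula → Formula
  ¬′ φ = φ ⇒′ ⊥′

  _≐ₚ_ : Point → Point → Formula
  (x , y) ≐ₚ (x′ , y′) = x ≐ x′ ∧′ y ≐ y′

  between : Expr → Expr → Expr → Formula
  between a x b = a ≼ x ∧′ x ≼ b

  ball : Expr → Point → Formula
  ball r (x , y) = between (⊟ r) (x ⊕ y) r ∧′ between (⊟ r) (x ⊝ y) r

  -- The tower at p reaches both ends of the cell at the origin, the edge from (0 , 0) to (1 , 0).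
  covers : Point → Formula
  covers (x , y) = between (lit 1ℤ ⊝ s) (x ⊕ y) s ∧′ between (lit 1ℤ ⊝ s) (x ⊝ y) s

  doubly : Vector → Point → Point → Formula
  doubly d p q = covers (p ⊹ neg d) ∧′ covers (q ⊹ neg d) ∧′ ¬′ (p ≐ₚ q)

  -- A configuration of towers around an uncovered cell at the origin: the towers, in terms of the
  -- parameters var 1, var 2, … constrained by form, are present, and no two towers satisfy any of
  -- the formulas absent. The cell at shift is then covered by both t₁ and t₂.
  record Configuration : Set where
    constructor configuration
    field
      shift   : Vector
      t₁ t₂   : Point
      others  : List Point
      form    : Formula
      absent  : List Formula

    towers : List Point
    towers = t₁ ∷ t₂ ∷ others
  open Configuration

  -- Extreme points of balls of radius s: N and W around (0, 0), E and S around (1, 0), X around (0,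
  -- -1), Z around (-1, -1).
  N E S W X Z : Point
  N = lit 0ℤ , s
  E = lit 1ℤ ⊕ s , lit 0ℤ
  S = lit 1ℤ , ⊟ s
  W = ⊟ s , lit 0ℤ
  X = lit 0ℤ , lit -[1+ 0 ] ⊝ s
  Z = lit -[1+ 0 ] , lit -[1+ 0 ] ⊝ s

  -- The patterns that take precedence: a doubly covered neighbour on either side, and the mirror
  -- image of configuration 3 with a = 1.
  left right corner : Formula
  left = doubly (-[1+ 0 ] , 0ℤ) p₁ p₂
  right = doubly (1ℤ , 0ℤ) p₁ p₂
  corner = p₁ ≐ₚ (lit 1ℤ , s) ∧′ p₂ ≐ₚ (lit (+ 2) , s ⊝ lit 1ℤ)

  -- In 0 and 1 a neighbouring cell is doubly covered. In 2 to 5 one of the towers has an end of the cell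
  -- as the top or bottom corner of its ball. In 6 to 8 the towers N, E, S and W bound a diagonal gap one
  -- cell wide, and a fifth tower at the end of the gap overlaps one of them.
  configurations : List Configuration
  configurations =
      configuration (-[1+ 0 ] , 0ℤ) p₁ p₂ [] left []
    ∷ configuration (1ℤ , 0ℤ) p₁ p₂ [] right []
    ∷ configuration (-[1+ 0 ] , 1ℤ) N (⊟ a , s ⊝ a) [] (between (lit 1ℤ) a (s ⊝ lit 1ℤ)) (left ∷ right ∷ [])
    ∷ configuration (1ℤ , -[1+ 0 ]) S (lit 1ℤ ⊕ a , a ⊝ s) [] (between (lit 1ℤ) a (s ⊝ lit 1ℤ)) (left ∷ right ∷ [])
    ∷ configuration (0ℤ , 1ℤ) N (lit 1ℤ ⊕ s ⊝ a , a) [] (between (lit 1ℤ) a s) (left ∷ right ∷ corner ∷ [])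
    ∷ configuration (0ℤ , 1ℤ) (lit 1ℤ , s) (⊟ a , s ⊝ a) [] (between (lit 0ℤ) a (s ⊝ lit 1ℤ)) (left ∷ right ∷ corner ∷ [])
    ∷ configuration (-[1+ 1 ] , -[1+ 0 ]) W (a ⊝ lit 1ℤ ⊝ s , ⊟ a) (N ∷ S ∷ E ∷ []) (between (lit 1ℤ) a s)
        (left ∷ right ∷ [])
    ∷ configuration (-[1+ 0 ] , -[1+ 1 ]) X Z (N ∷ W ∷ S ∷ E ∷ []) (lit 0ℤ ≼ lit 0ℤ) (left ∷ right ∷ [])
    ∷ configuration (0ℤ , -[1+ 1 ]) S X (N ∷ W ∷ E ∷ p₁ ∷ [])
        (covers (p₁ ⊹ (1ℤ , 1ℤ)) ∨′ covers (p₁ ⊹ (+ 2 , 1ℤ)) ∧′ ¬′ (p₁ ≐ₚ W)) (left ∷ right ∷ [])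
    ∷ []
    where
    a : Expr
    a = var 1

  config : Fin 9 → Configuration
  config = lookup configurations

  big : Formula
  big = lit (+ 2) ≼ s

  ⋁ : List Formula → Formula
  ⋁ = foldr _∨′_ ⊥′

  ⟦_⟧ₚ : Point → Env → Vector
  ⟦ x , y ⟧ₚ ρ = ⟦ x ⟧ₑ ρ , ⟦ y ⟧ₑ ρ

  View : Set₁
  View = Vector → Set

  Blocks : ℤ → View → Formula → Set
  Blocks σ V ψ = ∀ x y x′ y′ → V (x , y) → V (x′ , y′) → ¬ ⟦ ψ ⟧ (env (σ ∷ x ∷ y ∷ x′ ∷ y′ ∷ []))

  Uncovered : ℤ → View → Set
  Uncovered σ V = ∀ x y → V (x , y) → ¬ ⟦ covers p₁ ⟧ (env (σ ∷ x ∷ y ∷ []))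

  record At (σ : ℤ) (V : View) (r : Configuration) : Set where
    constructor at
    field
      ρ         : Env
      radius    : ρ 0 ≡ σ
      formed    : ⟦ form r ⟧ ρ
      present   : All (λ p → V (⟦ p ⟧ₚ ρ)) (towers r)
      blocked   : All (Blocks σ V) (absent r)
      uncovered : Uncovered σ V
  open At

  at-map : ∀ {σ V V′ r} → (∀ v → V v → V′ v) → (∀ v → V′ v → V v) → At σ V r → At σ V′ r
  at-map f g (at ρ e h ts bs u) =
    at ρ e h (All.map (f _) ts) (All.map (λ k x y x′ y′ v v′ → k x y x′ y′ (g _ v) (g _ v′)) bs) (λ x y v → u x y (g _ v))

  double? : Configuration → Bool
  double? r = valid? (big ⇒′ form r ⇒′ doubly (shift r) (t₁ r) (t₂ r))

  double-valid : ∀ i → T (double? (config i))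
  double-valid = toWitness {a? = Finₚ.all? λ i → T? (double? (config i))} _

  -- Two configurations with a common target, in common coordinates.

  double-index : ℕ → ℕ
  double-index zero = zero
  double-index (suc n) = suc (suc (double-index n))

  -- The two copies share the variable s.
  evens odds : ℕ → Expr
  evens n = var (double-index n)
  odds zero = s
  odds (suc n) = var (suc (double-index (suc n)))

  interleave : Env → Env → Env
  interleave f g zero = f 0
  interleave f g (suc n) = interleave g (f ∘ suc) n

  interleave-even : ∀ f g n → interleave f g (double-index n) ≡ f n
  interleave-even f g zero = refl
  interleave-even f g (suc n) = interleave-even (f ∘ suc) (g ∘ suc) n

  interleave-odd : ∀ f g n → interleave f g (suc (double-index n)) ≡ g n
  interleave-odd f g n = interleave-even g (f ∘ suc) n

  subₚ : (ℕ → Expr) → Point → Point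
  subₚ σ (x , y) = subₑ σ x , subₑ σ y

  pick : Point → Point → ℕ → Expr
  pick p q 0 = s
  pick p q 1 = proj₁ p
  pick p q 2 = proj₂ p
  pick p q 3 = proj₁ q
  pick p q 4 = proj₂ q
  pick p q _ = lit 0ℤ

  -- The position of the second uncovered cell seen from the first, given that both displacements
  -- end at the same cell; b tells whether the two are oppositely oriented.
  offset : Bool → Configuration → Configuration → Vector
  offset b r r′ = shift r − flip b (shift r′)

  -- The towers of two configurations with the same target, each in the coordinates of both.
  joint : Bool → Configuration → Configuration → List (Point × Point)
  joint b r r′ =
    map (λ p → p , flipₚ b (p ⊹ neg d)) (map (subₚ evens) (towers r)) ++
    map (λ p → flipₚ b p ⊹ d , p) (map (subₚ odds) (towers r′))
    where
    d : Vector
    d = offset b r r′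

  cover-clash : Point × Point → Formula
  cover-clash (p , p′) = covers p ∨′ covers p′

  pair-clash : Configuration → Configuration → List (Point × Point) → List (Point × Point) → Formula
  pair-clash r r′ ((p , p′) ∷ _) ((q , q′) ∷ _) =
    cover-clash (q , q′) ∨′ ⋁ (map (sub (pick p q)) (absent r)) ∨′ ⋁ (map (sub (pick p′ q′)) (absent r′))
  pair-clash r r′ _ _ = ⊥′

  both : Configuration → Configuration → Formula
  both r r′ = big ∧′ sub evens (form r) ∧′ sub odds (form r′)

  -- Positions in joint of two towers that rule out a pair of configurations
  -- which no single tower rules out.
  hint : Bool → ℕ → ℕ → ℕ × ℕ
  hint false 3 8 = 5 , 7
  hint true 6 8 = 0 , 5
  hint _ _ _ = 2 , 6

  same? : Bool → Configuration → Configuration → Bool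
  same? b r r′ = ⌊ ×-≡-dec ℤₚ._≟_ ℤₚ._≟_ (offset b r r′) (0ℤ , 0ℤ) ⌋

  clashing? : Bool → Configuration → Configuration → ℕ × ℕ → Bool
  clashing? b r r′ (m , n) =
    any (λ p → valid? (both r r′ ⇒′ cover-clash p)) ts ∨ valid? (both r r′ ⇒′ pair-clash r r′ (drop m ts) (drop n ts))
    where
    ts : List (Point × Point)
    ts = joint b r r′

  -- The condition is symmetric, so entries with j < i are waived. At offset zero the two uncovered
  -- cells are one cell and there is no conflict; otherwise a simultaneous realisation must be
  -- contradictory.
  exclusive? : Bool → Fin 9 → Fin 9 → Bool
  exclusive? b i j =
    (toℕ j ℕ.<ᵇ toℕ i) ∨ same? b (config i) (config j) ∨ clashing? b (config i) (config j) (hint b (toℕ i) (toℕ j))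

  table : ∀ b i j → T (exclusive? b i j)
  table false = toWitness {a? = Finₚ.all? λ i → Finₚ.all? λ j → T? (exclusive? false i j)} _
  table true = toWitness {a? = Finₚ.all? λ i → Finₚ.all? λ j → T? (exclusive? true i j)} _

  flip-eval : ∀ b p ρ → ⟦ flipₚ b p ⟧ₚ ρ ≡ flip b (⟦ p ⟧ₚ ρ)
  flip-eval false p ρ = refl
  flip-eval true p ρ = refl

  _+ᵥ_ : Vector → Vector → Vector
  (a , b) +ᵥ (c , d) = a + c , b + d

  Covering : ℤ → Vector → Set
  Covering σ (x , y) = ⟦ covers p₁ ⟧ (env (σ ∷ x ∷ y ∷ []))

  double-at : ∀ {σ V} r → T (double? r) → + 2 ≤ σ → At σ V r →
    ∃[ u ] ∃[ v ] u ≢ v × V u × V v × Covering σ (u +ᵥ neg (shift r)) × Covering σ (v +ᵥ neg (shift r))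
  double-at {σ} r e 2≤σ A@(at ρ e₀ h (v₁ ∷ v₂ ∷ _) _ _) =
    ⟦ t₁ r ⟧ₚ ρ , ⟦ t₂ r ⟧ₚ ρ , apart , v₁ , v₂ ,
    resize (⟦ t₁ r ⟧ₚ ρ +ᵥ neg (shift r)) e₀ h₁ , resize (⟦ t₂ r ⟧ₚ ρ +ᵥ neg (shift r)) e₀ h₂
    where
    doubled : ⟦ doubly (shift r) (t₁ r) (t₂ r) ⟧ ρ
    doubled = valid-sound (big ⇒′ form r ⇒′ doubly (shift r) (t₁ r) (t₂ r))
        (Equivalence.to T-≡ e) ρ (subst (+ 2 ≤_) (sym e₀) 2≤σ) h
    h₁ : ⟦ covers (t₁ r ⊹ neg (shift r)) ⟧ ρ
    h₁ = proj₁ doubled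
    h₂ : ⟦ covers (t₂ r ⊹ neg (shift r)) ⟧ ρ
    h₂ = proj₁ (proj₂ doubled)
    apart : ⟦ t₁ r ⟧ₚ ρ ≢ ⟦ t₂ r ⟧ₚ ρ
    apart e = proj₂ (proj₂ doubled) (cong proj₁ e , cong proj₂ e)
    resize : ∀ {τ} v → τ ≡ σ → Covering τ v → Covering σ v
    resize v refl h = h

  any-sound : ∀ {A : Set} {P : A → Set} (f : A → Bool) → (∀ x → f x ≡ true → P x → ⊥) →
    ∀ xs → All P xs → any f xs ≡ true → ⊥
  any-sound f g (x ∷ xs) (h ∷ hs) e with ∨-true {f x} e
  ... | inj₁ e₁ = g x e₁ h
  ... | inj₂ e₂ = any-sound f g xs hs e₂

  pick-env : ∀ {σ} p q ρ → ρ 0 ≡ σ → ∀ i → ⟦ pick p q i ⟧ₑ ρ ≡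
    env (σ ∷ ⟦ proj₁ p ⟧ₑ ρ ∷ ⟦ proj₂ p ⟧ₑ ρ ∷ ⟦ proj₁ q ⟧ₑ ρ ∷ ⟦ proj₂ q ⟧ₑ ρ ∷ []) i
  pick-env p q ρ e 0 = e
  pick-env p q ρ e 1 = refl
  pick-env p q ρ e 2 = refl
  pick-env p q ρ e 3 = refl
  pick-env p q ρ e 4 = refl
  pick-env p q ρ e (suc (suc (suc (suc (suc n))))) = refl

  blocks-⋁ : ∀ {σ V} p q ρ → ρ 0 ≡ σ → V (⟦ p ⟧ₚ ρ) → V (⟦ q ⟧ₚ ρ) → ∀ ψs → All (Blocks σ V) ψs →
    ¬ ⟦ ⋁ (map (sub (pick p q)) ψs) ⟧ ρ
  blocks-⋁ p q ρ e v w (ψ ∷ ψs) (b ∷ bs) (inj₁ h) = b _ _ _ _ v w (subst id (sub-eval (pick-env p q ρ e) ψ) h)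
  blocks-⋁ p q ρ e v w (ψ ∷ ψs) (b ∷ bs) (inj₂ h) = blocks-⋁ p q ρ e v w ψs bs h

  module Exclusive {σ : ℤ} {V V′ : View} (2≤σ : + 2 ≤ σ) (b : Bool) (r r′ : Configuration)
    (to   : ∀ v → V′ v → V (flip b v +ᵥ offset b r r′))
    (from : ∀ v → V v → V′ (flip b (v +ᵥ neg (offset b r r′))))
    (A : At σ V r) (A′ : At σ V′ r′) where

    σ≡ : ρ A′ 0 ≡ ρ A 0
    σ≡ = trans (radius A′) (sym (radius A))

    ρ⊔ : Env
    ρ⊔ = interleave (ρ A) (ρ A′)

    even-env : ∀ i → ⟦ evens i ⟧ₑ ρ⊔ ≡ ρ A i
    even-env i = interleave-even (ρ A) (ρ A′) i

    odd-env : ∀ i → ⟦ odds i ⟧ₑ ρ⊔ ≡ ρ A′ i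
    odd-env zero = sym σ≡
    odd-env (suc i) = interleave-odd (ρ A) (ρ A′) (suc i)

    sub-present : ∀ {W : View} {τ} {ρ′ : Env} → (∀ i → ⟦ τ i ⟧ₑ ρ⊔ ≡ ρ′ i) → ∀ ps →
      All (λ p → W (⟦ p ⟧ₚ ρ′)) ps → All (λ p → W (⟦ p ⟧ₚ ρ⊔)) (map (subₚ τ) ps)
    sub-present h [] [] = []
    sub-present {W} h ((x , y) ∷ ps) (v ∷ vs) =
      subst W (sym (cong₂ _,_ (subₑ-eval h x) (subₑ-eval h y))) v ∷ sub-present {W} h ps vs

    Seen : Point × Point → Set
    Seen (p , p′) = V (⟦ p ⟧ₚ ρ⊔) × V′ (⟦ p′ ⟧ₚ ρ⊔)

    all-seen : All Seen (joint b r r′)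
    all-seen = Allₚ.++⁺
      (Allₚ.map⁺ (All.map (λ {p} v → v , subst V′ (sym (flip-eval b (p ⊹ neg (offset b r r′)) ρ⊔)) (from _ v))
        (sub-present {V} even-env (towers r) (present A))))
      (Allₚ.map⁺ (All.map (λ {p} v → subst V (sym (cong (_+ᵥ offset b r r′) (flip-eval b p ρ⊔))) (to _ v) , v)
        (sub-present {V′} odd-env (towers r′) (present A′))))

    both-hold : ⟦ both r r′ ⟧ ρ⊔
    both-hold = subst (+ 2 ≤_) (sym (radius A)) 2≤σ
              , subst id (sym (sub-eval even-env (form r))) (formed A)
              , subst id (sym (sub-eval odd-env (form r′))) (formed A′)

    covers-radius : ∀ {W : View} → Uncovered σ W → ∀ p → W (⟦ p ⟧ₚ ρ⊔) → ¬ ⟦ covers p ⟧ ρ⊔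
    covers-radius u (x , y) v h =
      u _ _ v (subst (λ z → ⟦ covers p₁ ⟧ (env (z ∷ ⟦ x ⟧ₑ ρ⊔ ∷ ⟦ y ⟧ₑ ρ⊔ ∷ []))) (radius A) h)

    no-cover : ∀ p → Seen p → ¬ ⟦ cover-clash p ⟧ ρ⊔
    no-cover (p , p′) (v , v′) (inj₁ h) = covers-radius {V} (uncovered A) p v h
    no-cover (p , p′) (v , v′) (inj₂ h) = covers-radius {V′} (uncovered A′) p′ v′ h

    no-pair : ∀ ps qs → All Seen ps → All Seen qs → ¬ ⟦ pair-clash r r′ ps qs ⟧ ρ⊔
    no-pair (_ ∷ _) (q ∷ _) (_ ∷ _) (w ∷ _) (inj₁ h) = no-cover q w h
    no-pair ((p , _) ∷ _) ((q , _) ∷ _) ((v , _) ∷ _) ((w , _) ∷ _) (inj₂ (inj₁ h)) =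
      blocks-⋁ {V = V} p q ρ⊔ (radius A) v w (absent r) (blocked A) h
    no-pair ((_ , p) ∷ _) ((_ , q) ∷ _) ((_ , v) ∷ _) ((_ , w) ∷ _) (inj₂ (inj₂ h)) =
      blocks-⋁ {V = V′} p q ρ⊔ (radius A) v w (absent r′) (blocked A′) h
    no-pair [] _ _ _ ()
    no-pair (_ ∷ _) [] _ _ ()

    not-clashing : ∀ mn → ¬ T (clashing? b r r′ mn)
    not-clashing (m , n) c =
      [ (λ e → any-sound _ (λ p e₁ h → no-cover p h (valid-sound (both r r′ ⇒′
          cover-clash p) e₁ ρ⊔ both-hold)) _ all-seen e)
      , (λ e → no-pair _ _ (Allₚ.drop⁺ m all-seen) (Allₚ.drop⁺ n all-seen)
          (valid-sound (both r r′ ⇒′ pair-clash r r′ (drop m (joint b r r′)) (drop n (joint b r r′))) e ρ⊔ both-hold)) ]′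
      (∨-true {any (λ p → valid? (both r r′ ⇒′ cover-clash p)) (joint b r r′)} (Equivalence.to T-≡ c))

-- Every uncovered cell realises a configuration, up to reflection.

module UncoveredCells where
  open LinearArithmetic
  open Configurations
  open import Data.Bool using (Bool; true; false; T)
  open import Data.Empty using (⊥-elim)
  open import Data.Fin using (Fin; zero; suc; #_)
  open import Data.Integer using (ℤ; +_; -[1+_]; _+_; -_; _-_; _≤_; 0ℤ; 1ℤ)
  import Data.Integer.Properties as ℤₚ
  open import Data.List using (List; []; _∷_; map)
  open import Data.List.Relation.Unary.All as All using (All; []; _∷_)
  open import Data.Nat using (ℕ; zero; suc)
  open import Data.Product using (_×_; _,_; proj₁; proj₂; ∃-syntax)
  open import Data.Sum using (_⊎_; inj₁; inj₂; [_,_]′)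
  open import Function using (_∘_; id)
  open import Relation.Binary.PropositionalEquality
  open import Relation.Nullary using (¬_; Dec; yes; no)
  open import Relation.Nullary.Decidable using (_×-dec_)

  open Configuration

  param : List Expr → ℕ → Expr
  param es zero = s
  param [] (suc i) = lit 0ℤ
  param (e ∷ es) (suc zero) = e
  param (e ∷ es) (suc (suc i)) = param es (suc i)

  placed : Bool → List Point → List Point → Formula
  placed c [] [] = lit 0ℤ ≼ lit 0ℤ
  placed c (t ∷ ts) (q ∷ qs) = q ≐ₚ flipₚ c t ∧′ placed c ts qs
  placed c _ _ = ⊥′

  -- With the parameters replaced by `es`, the towers of configuration i, reflected if c is true,
  -- are exactly the points `qs` in this order.
  fits : Bool → Fin 9 → List Expr → List Point → Formula
  fits c i es qs = sub (param es) (form (config i)) ∧′ placed c (map (subₚ (param es)) (towers (config i))) qs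

  module _ {σ : ℤ} {V : View} where
    placed-present : ∀ c es ρ {ρ′} → (∀ i → ⟦ param es i ⟧ₑ ρ ≡ ρ′ i) → ∀ ts qs → All (λ q → V (⟦ q ⟧ₚ ρ)) qs →
      ⟦ placed c (map (subₚ (param es)) ts) qs ⟧ ρ → All (λ t → V (flip c (⟦ t ⟧ₚ ρ′))) ts
    placed-present c es ρ h [] [] _ _ = []
    placed-present c es ρ h (t ∷ ts) (q ∷ qs) (v ∷ vs) (e , es′) =
      subst V (trans (cong₂ _,_ (proj₁ e) (proj₂ e)) (trans (flip-eval c (subₚ (param es) t) ρ)
        (cong (flip c) (cong₂ _,_ (subₑ-eval h (proj₁ t)) (subₑ-eval h (proj₂ t)))))) v
      ∷ placed-present c es ρ h ts qs vs es′

    realise : ∀ c i es qs ρ → ρ 0 ≡ σ → All (λ q → V (⟦ q ⟧ₚ ρ)) qs → ⟦ fits c i es qs ⟧ ρ →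
      All (Blocks σ (V ∘ flip c)) (absent (config i)) → Uncovered σ (V ∘ flip c) → At σ (V ∘ flip c) (config i)
    realise c i es qs ρ e vs (h , p) bs u = at (λ j → ⟦ param es j ⟧ₑ ρ) e
      (subst id (sub-eval {σ = param es} (λ _ → refl) (form (config i))) h)
      (placed-present c es ρ (λ _ → refl) (towers (config i)) qs vs p) bs u

  around : Vector → Point → Point
  around (a , b) (x , y) = x ⊝ lit a , y ⊝ lit b

  near inside : Vector → Formula
  near v = ball s (around v p₁)
  inside v = ball (s ⊝ lit 1ℤ) (around v p₁)

  -- Signal at least 2 at v, for towers of signal s + 1 - distance: one tower contributes 2, or two
  -- distinct towers contribute at least 1 each.
  Supplied : ℤ → View → Vector → Set
  Supplied σ V v =
    (∃[ x ] ∃[ y ] V (x , y) × ⟦ inside v ⟧ (env (σ ∷ x ∷ y ∷ []))) ⊎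
    (∃[ x ] ∃[ y ] ∃[ x′ ] ∃[ y′ ] V (x , y) × V (x′ , y′) × ¬ (x ≡ x′ × y ≡ y′) ×
      ⟦ near v ⟧ (env (σ ∷ x ∷ y ∷ [])) × ⟦ near v ⟧ (env (σ ∷ x′ ∷ y′ ∷ [])))

  -- An uncovered cell to which configurations 0 and 1 do not apply.
  record Hole (σ : ℤ) (V : View) : Set where
    field
      2≤σ       : + 2 ≤ σ
      V?        : ∀ v → Dec (V v)
      supplied  : ∀ v → Supplied σ V v
      uncovered : Uncovered σ V
      no-left   : Blocks σ V left
      no-right  : Blocks σ V right

  neg² : ∀ {V : View} {x y} → V (x , y) → V (x , - (- y))
  neg² {V} {x} {y} = subst (λ z → V (x , z)) (sym (ℤₚ.neg-involutive y))

  neg²⁻ : ∀ {V : View} {x y} → V (x , - (- y)) → V (x , y)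
  neg²⁻ {V} {x} {y} = subst (λ z → V (x , z)) (ℤₚ.neg-involutive y)

  p₁′ p₂′ : Point
  p₁′ = flipₚ true p₁
  p₂′ = flipₚ true p₂

  flip-hole : ∀ {σ V} → Hole σ V → Hole σ (V ∘ flip true)
  flip-hole {σ} {V} H = record
    { 2≤σ = 2≤σ
    ; V? = V? ∘ flip true
    ; supplied = λ (a , b) → mirror a b (supplied (a , - b))
    ; uncovered = λ x y v h → uncovered x (- y) v (by (covers p₁ ⇒′ covers p₁′) (σ ∷ x ∷ y ∷ []) h)
    ; no-left = λ x y x′ y′ v v′ h → no-left x (- y) x′ (- y′) v v′
        (by (left ⇒′ doubly (-[1+ 0 ] , 0ℤ) p₁′ p₂′) (σ ∷ x ∷ y ∷ x′ ∷ y′ ∷ []) h)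
    ; no-right = λ x y x′ y′ v v′ h → no-right x (- y) x′ (- y′) v v′
        (by (right ⇒′ doubly (1ℤ , 0ℤ) p₁′ p₂′) (σ ∷ x ∷ y ∷ x′ ∷ y′ ∷ []) h)
    }
    where
    open Hole H
    reflect : Expr → Formula
    reflect r = ball r (var 1 ⊝ var 3 , var 2 ⊝ ⊟ var 4) ⇒′ ball r (var 1 ⊝ var 3 , ⊟ var 2 ⊝ var 4)
    mirror : ∀ a b → Supplied σ V (a , - b) → Supplied σ (V ∘ flip true) (a , b)
    mirror a b (inj₁ (x , y , v , h)) = inj₁ (x , - y , neg² {V} v , by (reflect (s ⊝ lit 1ℤ)) (σ ∷ x ∷ y ∷ a ∷ b ∷ []) h)
    mirror a b (inj₂ (x , y , x′ , y′ , v , v′ , n , h , h′)) =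
      inj₂ (x , - y , x′ , - y′ , neg² {V} v , neg² {V} v′ , (λ (e , e′) → n (e , ℤₚ.neg-injective e′)) ,
        by (reflect s) (σ ∷ x ∷ y ∷ a ∷ b ∷ []) h , by (reflect s) (σ ∷ x′ ∷ y′ ∷ a ∷ b ∷ []) h′)

  Outcome : ℤ → View → Set
  Outcome σ V = ∃[ c ] ∃[ i ] At σ (V ∘ flip c) (config i)

  flip-outcome : ∀ {σ V} → Outcome σ (V ∘ flip true) → Outcome σ V
  flip-outcome (false , i , A) = true , i , A
  flip-outcome {V = V} (true , i , A) = false , i , at-map (λ (x , y) → neg²⁻ {V}) (λ (x , y) → neg² {V}) A

  module AtHole {σ : ℤ} {V : View} (H : Hole σ V) where
    open Hole H

    oriented : ∀ c → Hole σ (V ∘ flip c)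
    oriented false = H
    oriented true = flip-hole H

    outcome : ∀ c i es qs ρ → ρ 0 ≡ σ → All (λ q → V (⟦ q ⟧ₚ ρ)) qs → ⟦ fits c i es qs ⟧ ρ →
      All (Blocks σ (V ∘ flip c)) (absent (config i)) → Outcome σ V
    outcome c i es qs ρ e vs h bs = c , i , realise {V = V} c i es qs ρ e vs h bs (Hole.uncovered (oriented c))

    sides : ∀ c → All (Blocks σ (V ∘ flip c)) (left ∷ right ∷ [])
    sides c = Hole.no-left (oriented c) ∷ Hole.no-right (oriented c) ∷ []

    -- A tower that is not interior to the ball around v cannot supply v alone: either an interior
    -- tower exists, which is a different one, or one of two distinct towers differs from it.
    other : ∀ v x y → V (x , y) → ¬ ⟦ inside v ⟧ (env (σ ∷ x ∷ y ∷ [])) →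
      ∃[ x′ ] ∃[ y′ ] V (x′ , y′) × ¬ (x ≡ x′ × y ≡ y′) × ⟦ near v ⟧ (env (σ ∷ x′ ∷ y′ ∷ []))
    other v@(a , b) x y t n with supplied v
    ... | inj₁ (x′ , y′ , t′ , h) = x′ , y′ , t′ , (λ { (refl , refl) → n h }) ,
      by (ball (s ⊝ lit 1ℤ) (var 1 ⊝ var 3 , var 2 ⊝ var 4) ⇒′ ball s (var 1 ⊝ var 3 , var 2 ⊝ var 4))
          (σ ∷ x′ ∷ y′ ∷ a ∷ b ∷ []) h
    ... | inj₂ (x₁ , y₁ , x₂ , y₂ , t₁ , t₂ , d , h₁ , h₂) with (x ℤₚ.≟ x₁) ×-dec (y ℤₚ.≟ y₁)
    ...   | no e = x₁ , y₁ , t₁ , e , h₁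
    ...   | yes (refl , refl) = x₂ , y₂ , t₂ , d , h₂

    -- Neither tower is interior to the end v of the cell, since such a tower would cover the cell.
    pair : ∀ v → T (valid? (big ⇒′ inside v ⇒′ covers p₁)) →
      ∃[ x ] ∃[ y ] ∃[ x′ ] ∃[ y′ ] V (x , y) × V (x′ , y′) × ¬ (x ≡ x′ × y ≡ y′) ×
        ⟦ near v ⟧ (env (σ ∷ x ∷ y ∷ [])) × ⟦ near v ⟧ (env (σ ∷ x′ ∷ y′ ∷ []))
    pair v e with supplied v
    ... | inj₁ (x , y , t , h) = ⊥-elim (uncovered x y t (by (big ⇒′ inside v ⇒′ covers p₁) (σ ∷ x ∷ y ∷ []) {e} 2≤σ h))
    ... | inj₂ p = p

    -- Two towers adjacent diagonally in this way give the configuration 3, which takes precedence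
    -- over 4 and 5.
    edge : ∀ i → absent (config i) ≡ left ∷ right ∷ corner ∷ [] → ∀ c es qs ρ → ρ 0 ≡ σ →
      All (λ q → V (⟦ q ⟧ₚ ρ)) qs → ⟦ fits c i es qs ⟧ ρ → Outcome σ V
    edge i e c es qs ρ ρ≡ vs h with Hole.V? (oriented c) (1ℤ , σ) ×-dec Hole.V? (oriented c) (+ 2 , σ - 1ℤ)
    ... | no n = outcome c i es qs ρ ρ≡ vs h (subst (All _) (sym e)
        (Hole.no-left (oriented c) ∷ Hole.no-right (oriented c) ∷
      (λ { x y x′ y′ v v′ ((refl , refl) , refl , refl) → n (v , v′) }) ∷ []))
    edge i e false es qs ρ ρ≡ vs h | yes (v , v′) =
      outcome true (# 3) (lit 1ℤ ∷ []) (p₁ ∷ p₂ ∷ []) (env (σ ∷ 1ℤ ∷ σ ∷ + 2 ∷ σ - 1ℤ ∷ [])) refl (v ∷ v′ ∷ [])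
        (by (big ⇒′ corner ⇒′ fits true (# 3) (lit 1ℤ ∷ []) (p₁ ∷ p₂ ∷ []))
            (σ ∷ 1ℤ ∷ σ ∷ + 2 ∷ σ - 1ℤ ∷ []) 2≤σ ((refl , refl) , refl , refl))
        (sides true)
    edge i e true es qs ρ ρ≡ vs h | yes (v , v′) =
      outcome false (# 3) (lit 1ℤ ∷ []) (p₁ ∷ p₂ ∷ []) (env (σ ∷ 1ℤ ∷ - σ ∷ + 2 ∷ - (σ - 1ℤ) ∷ [])) refl (v ∷ v′ ∷ [])
        (by (big ⇒′ p₁ ≐ₚ (lit 1ℤ , ⊟ s) ∧′ p₂ ≐ₚ (lit (+ 2) , ⊟ (s ⊝ lit 1ℤ)) ⇒′ fits false (# 3) (lit 1ℤ ∷ [])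
            (p₁ ∷ p₂ ∷ []))
          (σ ∷ 1ℤ ∷ - σ ∷ + 2 ∷ - (σ - 1ℤ) ∷ []) 2≤σ ((refl , refl) , refl , refl))
        (sides false)

    -- The tower (x, y) is the second one supplying (0, -1). Since W covers the left neighbour and E
    -- the right one, it covers neither of these cells. What remains is the lower left side of the
    -- ball around (0, -1), which is configuration 6, the point (0, -s), which together with S is a
    -- reflected configuration 4, and the bottom corner X.
    pin : ∀ x y → V (x , y) → V (0ℤ , σ) → V (- σ , 0ℤ) → V (1ℤ , - σ) → V (1ℤ + σ , 0ℤ) →
      ¬ (1ℤ ≡ x × - σ ≡ y) → ⟦ near (0ℤ , -[1+ 0 ]) ⟧ (env (σ ∷ x ∷ y ∷ [])) → Outcome σ V
    pin x y t n w o e d h =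
      [ (λ k → outcome false (# 6) (⊟ var 2 ∷ []) (W ∷ p₁ ∷ N ∷ S ∷ E ∷ []) ρ₁ refl (w ∷ t ∷ n ∷ o ∷ e ∷ [])
          (by (slope ⇒′ fits false (# 6) (⊟ var 2 ∷ []) (W ∷ p₁ ∷ N ∷ S ∷ E ∷ [])) (σ ∷ x ∷ y ∷ []) k) (sides false))
      , [ (λ { (refl , refl) → edge (# 4) refl true (s ∷ []) ((lit 0ℤ , ⊟ s) ∷ S ∷ []) (env (σ ∷ [])) refl (t ∷ o ∷ [])
            (by (big ⇒′ fits true (# 4) (s ∷ []) ((lit 0ℤ , ⊟ s) ∷ S ∷ [])) (σ ∷ []) 2≤σ) })
        , (λ { (refl , refl) → below t (V? (-[1+ 0 ] , -[1+ 0 ] - σ)) }) ]′ ]′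
      (by (big ⇒′ near (0ℤ , -[1+ 0 ]) ⇒′ ¬′ covers p₁ ⇒′ ¬′ reachesˡ ⇒′ ¬′ reachesʳ ⇒′ ¬′ (S ≐ₚ p₁) ⇒′
           slope ∨′ p₁ ≐ₚ (lit 0ℤ , ⊟ s) ∨′ p₁ ≐ₚ X)
        (σ ∷ x ∷ y ∷ []) 2≤σ h (uncovered x y t)
        (by (big ⇒′ near (0ℤ , -[1+ 0 ]) ⇒′ ¬′ doubly (-[1+ 0 ] , 0ℤ) W p₁ ⇒′ ¬′ reachesˡ)
          (σ ∷ x ∷ y ∷ []) 2≤σ h (no-left _ _ x y w t))
        (by (big ⇒′ near (0ℤ , -[1+ 0 ]) ⇒′ ¬′ doubly (1ℤ , 0ℤ) E p₁ ⇒′ ¬′ reachesʳ)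
          (σ ∷ x ∷ y ∷ []) 2≤σ h (no-right _ _ x y e t))
        d)
      where
      ρ₁ : Env
      ρ₁ = env (σ ∷ x ∷ y ∷ [])
      reachesˡ reachesʳ slope : Formula
      reachesˡ = covers (p₁ ⊹ (1ℤ , 0ℤ))
      reachesʳ = covers (p₁ ⊹ (-[1+ 0 ] , 0ℤ))
      slope = var 1 ⊕ var 2 ≐ lit -[1+ 0 ] ⊝ s ∧′ var 2 ≼ lit -[1+ 0 ] ∧′ ⊟ s ≼ var 2
      below : V (0ℤ , -[1+ 0 ] - σ) → Dec (V (-[1+ 0 ] , -[1+ 0 ] - σ)) → Outcome σ V
      below t (yes z) = outcome false (# 7) [] (X ∷ Z ∷ N ∷ W ∷ S ∷ E ∷ []) (env (σ ∷ [])) refl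
        (t ∷ z ∷ n ∷ w ∷ o ∷ e ∷ []) (by (fits false (# 7) [] (X ∷ Z ∷ N ∷ W ∷ S ∷ E ∷ [])) (σ ∷ [])) (sides false)
      -- W is at distance exactly s from (-1, -1), so this vertex needs another tower, which becomes
      -- the parameter `p₁` of configuration 8.
      below t (no ¬z) = beside t ¬z (other (-[1+ 0 ] , -[1+ 0 ]) (- σ) 0ℤ w
        (by (big ⇒′ ¬′ ball (s ⊝ lit 1ℤ) (around (-[1+ 0 ] , -[1+ 0 ]) W)) (σ ∷ []) 2≤σ))
        where
        ts : List Point
        ts = S ∷ X ∷ N ∷ W ∷ E ∷ p₁ ∷ []
        beside : V (0ℤ , -[1+ 0 ] - σ) → ¬ V (-[1+ 0 ] , -[1+ 0 ] - σ) →
          ∃[ x′ ] ∃[ y′ ] V (x′ , y′) × ¬ (- σ ≡ x′ × 0ℤ ≡ y′) × ⟦ near (-[1+ 0 ] , -[1+ 0 ]) ⟧ (env (σ ∷ x′ ∷ y′ ∷ [])) →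
          Outcome σ V
        beside t ¬z (x′ , y′ , z , d′ , h′) = outcome false (# 8) (var 1 ∷ var 2 ∷ []) ts (env (σ ∷ x′ ∷ y′ ∷ [])) refl
          (o ∷ t ∷ n ∷ w ∷ e ∷ z ∷ [])
          (k , by (placed false (map (subₚ (param (var 1 ∷ var 2 ∷ []))) (towers (config (# 8)))) ts) (σ ∷ x′ ∷ y′ ∷ []))
          (sides false)
          where
          k : ⟦ form (config (# 8)) ⟧ (env (σ ∷ x′ ∷ y′ ∷ []))
          k = by (big ⇒′ near (-[1+ 0 ] , -[1+ 0 ]) ⇒′ ¬′ covers p₁ ⇒′ ¬′ (p₁ ≐ₚ W) ⇒′ ¬′ (p₁ ≐ₚ Z) ⇒′
              ¬′ reachesˡ ⇒′ form (config (# 8)))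
            (σ ∷ x′ ∷ y′ ∷ []) 2≤σ h′ (uncovered x′ y′ z) (λ { (refl , refl) → d′ (refl , refl) })
                (λ { (refl , refl) → ¬z z })
            (by (big ⇒′ ¬′ (W ≐ₚ p₁) ⇒′ ¬′ doubly (-[1+ 0 ] , 0ℤ) W p₁ ⇒′ ¬′ reachesˡ)
              (σ ∷ x′ ∷ y′ ∷ []) 2≤σ d′ (no-left _ _ x′ y′ w z))

    O O′ : Vector
    O = 0ℤ , 0ℤ
    O′ = 1ℤ , 0ℤ

    -- The lower left side of the ball around (0, 0) and the upper right side of the ball around (1,
    -- 0), corners included.
    diagonal diagonal′ : Formula
    diagonal = var 1 ⊕ var 2 ≐ ⊟ s ∧′ lit 0ℤ ≼ ⊟ var 1 ∧′ ⊟ var 1 ≼ s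
    diagonal′ = var 1 ⊕ var 2 ≐ lit 1ℤ ⊕ s ∧′ lit 1ℤ ≼ var 1 ∧′ var 1 ≼ lit 1ℤ ⊕ s

    -- The second tower at (0, 0) lies on the upper left side of the ball, giving configuration 2,
    -- or on `diagonal`. In the latter case the end (1, 0) is examined: its two towers cannot both
    -- cover the right neighbour, so one of them is S or (1, s).
    north : V (0ℤ , σ) → ∀ x y → V (x , y) → ¬ (0ℤ ≡ x × σ ≡ y) → ⟦ near O ⟧ (env (σ ∷ x ∷ y ∷ [])) → Outcome σ V
    north n x y t d h =
      [ (λ k → outcome false (# 2) (⊟ var 1 ∷ []) (N ∷ p₁ ∷ []) (env (σ ∷ x ∷ y ∷ [])) refl (n ∷ t ∷ []) k (sides false))
      , opposite (pair O′ _) ]′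
      (by (big ⇒′ near O ⇒′ ¬′ covers p₁ ⇒′ ¬′ (N ≐ₚ p₁) ⇒′ fits false (# 2) (⊟ var 1 ∷ []) (N ∷ p₁ ∷ []) ∨′ diagonal)
        (σ ∷ x ∷ y ∷ []) 2≤σ h (uncovered x y t) d)
      where
      from-se : V (1ℤ , - σ) → ⟦ diagonal ⟧ (env (σ ∷ x ∷ y ∷ [])) →
        ∀ x′ y′ → V (x′ , y′) → ¬ (1ℤ ≡ x′ × - σ ≡ y′) → ⟦ near O′ ⟧ (env (σ ∷ x′ ∷ y′ ∷ [])) → Outcome σ V
      from-se o k x′ y′ t′ d′ h′ =
        [ (λ k′ → outcome false (# 3) (var 1 ⊝ lit 1ℤ ∷ []) (S ∷ p₁ ∷ [])
            (env (σ ∷ x′ ∷ y′ ∷ [])) refl (o ∷ t′ ∷ []) k′ (sides false))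
        , (λ k′ →
            [ (λ l → edge (# 4) refl false (var 4 ∷ []) (N ∷ p₂ ∷ []) ρ₂ refl (n ∷ t′ ∷ []) l)
            , [ (λ l → edge (# 5) refl true (⊟ var 1 ∷ []) (S ∷ p₁ ∷ []) ρ₂ refl (o ∷ t ∷ []) l)
              , (λ { ((refl , refl) , refl , refl) → pinned t t′ }) ]′ ]′
            (by (big ⇒′ diagonal ⇒′ sub (pick p₂ p₂) diagonal′ ⇒′
                 fits false (# 4) (var 4 ∷ []) (N ∷ p₂ ∷ []) ∨′ fits true (# 5) (⊟ var 1 ∷ []) (S ∷ p₁ ∷ []) ∨′
                     p₁ ≐ₚ W ∧′ p₂ ≐ₚ E)
              (σ ∷ x ∷ y ∷ x′ ∷ y′ ∷ []) 2≤σ k k′)) ]′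
        (by (big ⇒′ near O′ ⇒′ ¬′ covers p₁ ⇒′ ¬′ (S ≐ₚ p₁) ⇒′ fits false (# 3) (var 1 ⊝ lit 1ℤ ∷ [])
            (S ∷ p₁ ∷ []) ∨′ diagonal′)
          (σ ∷ x′ ∷ y′ ∷ []) 2≤σ h′ (uncovered x′ y′ t′) d′)
        where
        ρ₂ : Env
        ρ₂ = env (σ ∷ x ∷ y ∷ x′ ∷ y′ ∷ [])
        pinned : V (- σ , 0ℤ) → V (1ℤ + σ , 0ℤ) → Outcome σ V
        -- Among N, E, S and W only S reaches (0, -1), and only at distance exactly s, so a fifth
        -- tower must exist.
        pinned w e = enclosed (other (0ℤ , -[1+ 0 ]) 1ℤ (- σ) o
          (by (big ⇒′ ¬′ ball (s ⊝ lit 1ℤ) (around (0ℤ , -[1+ 0 ]) S)) (σ ∷ []) 2≤σ))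
          where
          enclosed : ∃[ u ] ∃[ v ] V (u , v) × ¬ (1ℤ ≡ u × - σ ≡ v) ×
              ⟦ near (0ℤ , -[1+ 0 ]) ⟧ (env (σ ∷ u ∷ v ∷ [])) → Outcome σ V
          enclosed (u , v , t″ , d″ , h″) = pin u v t″ n w o e d″ h″

      from-ne : V (1ℤ , σ) → Outcome σ V
      from-ne o = edge (# 4) refl false (s ∷ []) (N ∷ (lit 1ℤ , s) ∷ []) (env (σ ∷ [])) refl (n ∷ o ∷ [])
        (by (big ⇒′ fits false (# 4) (s ∷ []) (N ∷ (lit 1ℤ , s) ∷ [])) (σ ∷ []) 2≤σ)

      corner-or-covers : Formula
      corner-or-covers = p₁ ≐ₚ S ∨′ p₁ ≐ₚ (lit 1ℤ , s) ∨′ covers (p₁ ⊹ (-[1+ 0 ] , 0ℤ))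

      classify : ∀ x y → V (x , y) → ⟦ near O′ ⟧ (env (σ ∷ x ∷ y ∷ [])) → ⟦ corner-or-covers ⟧ (env (σ ∷ x ∷ y ∷ []))
      classify x y t h = by (big ⇒′ near O′ ⇒′ ¬′ covers p₁ ⇒′ corner-or-covers) (σ ∷ x ∷ y ∷ []) 2≤σ h (uncovered x y t)

      opposite : (∃[ x ] ∃[ y ] ∃[ x′ ] ∃[ y′ ] V (x , y) × V (x′ , y′) × ¬ (x ≡ x′ × y ≡ y′) ×
        ⟦ near O′ ⟧ (env (σ ∷ x ∷ y ∷ [])) × ⟦ near O′ ⟧ (env (σ ∷ x′ ∷ y′ ∷ []))) →
        ⟦ diagonal ⟧ (env (σ ∷ x ∷ y ∷ [])) → Outcome σ V
      opposite (x₁ , y₁ , x₂ , y₂ , t₁ , t₂ , d′ , h₁ , h₂) k with classify x₁ y₁ t₁ h₁ | classify x₂ y₂ t₂ h₂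
      ... | inj₁ (refl , refl) | _ = from-se t₁ k x₂ y₂ t₂ d′ h₂
      ... | inj₂ (inj₁ (refl , refl)) | _ = from-ne t₁
      ... | _ | inj₁ (refl , refl) = from-se t₂ k x₁ y₁ t₁ (λ { (refl , refl) → d′ (refl , refl) }) h₁
      ... | _ | inj₂ (inj₁ (refl , refl)) = from-ne t₂
      ... | inj₂ (inj₂ c₁) | inj₂ (inj₂ c₂) = ⊥-elim (no-right x₁ y₁ x₂ y₂ t₁ t₂ (c₁ , c₂ , d′))

  -- A tower at distance s from (0, 0) that misses the cell either is (0, s) or (0, -s) or covers
  -- the left neighbour. The two towers there cannot both do the last, so up to reflection `north`
  -- applies.
  resolve-hole : ∀ {σ V} → Hole σ V → Outcome σ V
  resolve-hole {σ} {V} H = start (pair O _)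
    where
    open Hole H
    open AtHole H

    turn : Formula
    turn = near O ⇒′ ball s (around O (flipₚ true p₁))

    corner-or-covers : Formula
    corner-or-covers = p₁ ≐ₚ (lit 0ℤ , s) ∨′ p₁ ≐ₚ (lit 0ℤ , ⊟ s) ∨′ covers (p₁ ⊹ (1ℤ , 0ℤ))

    classify : ∀ x y → V (x , y) → ⟦ near O ⟧ (env (σ ∷ x ∷ y ∷ [])) → ⟦ corner-or-covers ⟧ (env (σ ∷ x ∷ y ∷ []))
    classify x y t h = by (big ⇒′ near O ⇒′ ¬′ covers p₁ ⇒′ corner-or-covers) (σ ∷ x ∷ y ∷ []) 2≤σ h (uncovered x y t)

    south : V (0ℤ , - σ) → ∀ x y → V (x , y) → ¬ (0ℤ ≡ x × - σ ≡ y) → ⟦ near O ⟧ (env (σ ∷ x ∷ y ∷ [])) → Outcome σ V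
    south t x y t′ d h = flip-outcome {V = V} (AtHole.north (flip-hole H) t x (- y) (neg² {V} t′)
      (λ (e , e′) → d (e , trans (cong -_ e′) (ℤₚ.neg-involutive y)))
      (by turn (σ ∷ x ∷ y ∷ []) h))

    start : (∃[ x ] ∃[ y ] ∃[ x′ ] ∃[ y′ ] V (x , y) × V (x′ , y′) × ¬ (x ≡ x′ × y ≡ y′) ×
        ⟦ near O ⟧ (env (σ ∷ x ∷ y ∷ [])) × ⟦ near O ⟧ (env (σ ∷ x′ ∷ y′ ∷ []))) → Outcome σ V
    start (x₁ , y₁ , x₂ , y₂ , t₁ , t₂ , d , h₁ , h₂) with classify x₁ y₁ t₁ h₁ | classify x₂ y₂ t₂ h₂
    ... | inj₁ (refl , refl) | _ = north t₁ x₂ y₂ t₂ d h₂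
    ... | inj₂ (inj₁ (refl , refl)) | _ = south t₁ x₂ y₂ t₂ d h₂
    ... | _ | inj₁ (refl , refl) = north t₂ x₁ y₁ t₁ (λ { (refl , refl) → d (refl , refl) }) h₁
    ... | _ | inj₂ (inj₁ (refl , refl)) = south t₂ x₁ y₁ t₁ (λ { (refl , refl) → d (refl , refl) }) h₁
    ... | inj₂ (inj₂ c₁) | inj₂ (inj₂ c₂) = ⊥-elim (no-left x₁ y₁ x₂ y₂ t₁ t₂ (c₁ , c₂ , d))

-- Finite sums and sums of periodic functions over a period.

module Sums where
  open import Data.Integer as ℤ using (ℤ; +_; -[1+_]; 1ℤ)
  import Data.Integer.Properties as ℤₚ
  open import Data.Integer.Solver using () renaming (module +-*-Solver to ℤ-Solver)
  import Data.Integer.Divisibility.Signed as ℤ∣ₛ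
  open import Data.List using (List; []; _∷_; map; length)
  open import Data.Nat.ListAction using (sum)
  open import Data.List.Membership.Propositional using (_∈_)
  open import Data.List.Relation.Unary.All as All using (All; []; _∷_)
  open import Data.List.Relation.Unary.Any using (here; there)
  open import Data.List.Relation.Unary.AllPairs using ([]; _∷_)
  open import Data.List.Relation.Unary.Unique.Propositional using (Unique)
  open import Data.Nat as ℕ using (ℕ; zero; suc; _+_; _*_; _≤_; _<_; z≤n)
  import Data.Nat.Properties as ℕₚ
  import Data.Nat.Divisibility as ℕ∣
  open import Data.Nat.Solver using (module +-*-Solver)
  open import Data.Product using (∃; _×_; _,_)
  open import Data.Sum using (_⊎_; inj₁; inj₂)
  open import Data.Empty using (⊥-elim)
  open import Function using (_∘_)
  open import Relation.Binary.PropositionalEquality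
  open import Relation.Nullary using (¬_; Dec; yes; no)

  indicator : {A : Set} → Dec A → ℕ
  indicator (yes _) = 1
  indicator (no _) = 0

  indicator-yes : {A : Set} (d : Dec A) → A → indicator d ≡ 1
  indicator-yes (yes _) a = refl
  indicator-yes (no ¬a) a = ⊥-elim (¬a a)

  indicator-⇔ : {A B : Set} (d : Dec A) (e : Dec B) → (A → B) → (B → A) → indicator d ≡ indicator e
  indicator-⇔ (yes a) e f g = sym (indicator-yes e (f a))
  indicator-⇔ (no ¬a) (yes b) f g = ⊥-elim (¬a (g b))
  indicator-⇔ (no _) (no _) f g = refl

  +-interchange : ∀ a b c d → (a + b) + (c + d) ≡ (a + c) + (b + d)
  +-interchange = solve 4 (λ a b c d → (a :+ b) :+ (c :+ d) := (a :+ c) :+ (b :+ d)) refl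
    where open +-*-Solver

  ∑ : {A : Set} → List A → (A → ℕ) → ℕ
  ∑ xs f = sum (map f xs)

  module _ {A : Set} where
    ∑-const-≤ : ∀ (xs : List A) f c → (∀ x → f x ≤ c) → ∑ xs f ≤ length xs * c
    ∑-const-≤ [] f c h = z≤n
    ∑-const-≤ (x ∷ xs) f c h = ℕₚ.+-mono-≤ (h x) (∑-const-≤ xs f c h)

    ∑-cong : ∀ (xs : List A) {f g} → (∀ x → f x ≡ g x) → ∑ xs f ≡ ∑ xs g
    ∑-cong [] h = refl
    ∑-cong (x ∷ xs) h = cong₂ _+_ (h x) (∑-cong xs h)

    ∑-one : ∀ {xs : List A} {a} f → a ∈ xs → f a ≤ ∑ xs f
    ∑-one f (here refl) = ℕₚ.m≤m+n _ _
    ∑-one {x ∷ xs} f (there p) = ℕₚ.≤-trans (∑-one f p) (ℕₚ.m≤n+m _ (f x))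

    ∑-two : ∀ {xs : List A} {a b} f → a ≢ b → a ∈ xs → b ∈ xs → f a + f b ≤ ∑ xs f
    ∑-two f n (here refl) (here refl) = ⊥-elim (n refl)
    ∑-two f n (here refl) (there q) = ℕₚ.+-monoʳ-≤ _ (∑-one f q)
    ∑-two {b ∷ xs} {a} f n (there p) (here refl) =
      ℕₚ.≤-trans (ℕₚ.≤-reflexive (ℕₚ.+-comm (f a) (f b))) (ℕₚ.+-monoʳ-≤ (f b) (∑-one f p))
    ∑-two {x ∷ xs} f n (there p) (there q) = ℕₚ.≤-trans (∑-two f n p q) (ℕₚ.m≤n+m _ (f x))

    module _ {P : A → Set} (P? : ∀ x → Dec (P x)) where
      ∑-none : ∀ xs → All (λ x → ¬ P x) xs → ∑ xs (indicator ∘ P?) ≡ 0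
      ∑-none [] [] = refl
      ∑-none (x ∷ xs) (¬p ∷ ¬ps) with P? x
      ... | yes p = ⊥-elim (¬p p)
      ... | no _ = ∑-none xs ¬ps

      ∑-at-most-one : (∀ {x y} → P x → P y → x ≡ y) → ∀ {xs} → Unique xs →
        ∑ xs (indicator ∘ P?) ≡ 0 ⊎ (∃ P × ∑ xs (indicator ∘ P?) ≡ 1)
      ∑-at-most-one h [] = inj₁ refl
      ∑-at-most-one h {x ∷ xs} (n ∷ ns) with P? x
      ... | no _ = ∑-at-most-one h ns
      ... | yes p = inj₂ ((x , p) , cong suc (∑-none xs (All.map (λ x≢y q → x≢y (h p q)) n)))

  ∑< : ℕ → (ℕ → ℕ) → ℕ
  ∑< zero f = 0
  ∑< (suc n) f = f 0 + ∑< n (f ∘ suc)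

  ∑<-cong : ∀ n {f g} → (∀ i → f i ≡ g i) → ∑< n f ≡ ∑< n g
  ∑<-cong zero h = refl
  ∑<-cong (suc n) h = cong₂ _+_ (h 0) (∑<-cong n (h ∘ suc))

  ∑<-mono : ∀ n {f g} → (∀ i → f i ≤ g i) → ∑< n f ≤ ∑< n g
  ∑<-mono zero h = z≤n
  ∑<-mono (suc n) h = ℕₚ.+-mono-≤ (h 0) (∑<-mono n (h ∘ suc))

  ∑<-+ : ∀ n f g → ∑< n (λ i → f i + g i) ≡ ∑< n f + ∑< n g
  ∑<-+ zero f g = refl
  ∑<-+ (suc n) f g = trans (cong (_+_ (f 0 + g 0)) (∑<-+ n (f ∘ suc) (g ∘ suc))) (+-interchange (f 0) (g 0) _ _)

  ∑<-const : ∀ n c → ∑< n (λ _ → c) ≡ n * c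
  ∑<-const zero c = refl
  ∑<-const (suc n) c = cong (_+_ c) (∑<-const n c)

  ∑<-* : ∀ n c f → ∑< n (λ i → c * f i) ≡ c * ∑< n f
  ∑<-* zero c f = sym (ℕₚ.*-zeroʳ c)
  ∑<-* (suc n) c f = trans (cong (_+_ (c * f 0)) (∑<-* n c (f ∘ suc))) (sym (ℕₚ.*-distribˡ-+ c (f 0) _))

  ∑<-∑ : {A : Set} (xs : List A) → ∀ n (f : A → ℕ → ℕ) → ∑< n (λ i → ∑ xs (λ x → f x i)) ≡ ∑ xs (λ x → ∑< n (f x))
  ∑<-∑ [] n f = trans (∑<-const n 0) (ℕₚ.*-zeroʳ n)
  ∑<-∑ (x ∷ xs) n f = trans (∑<-+ n (f x) _) (cong (_+_ (∑< n (f x))) (∑<-∑ xs n f))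

  ∑<-last : ∀ n f → ∑< (suc n) f ≡ ∑< n f + f n
  ∑<-last zero f = ℕₚ.+-comm (f 0) 0
  ∑<-last (suc n) f = trans (cong (_+_ (f 0)) (∑<-last n (f ∘ suc))) (sym (ℕₚ.+-assoc (f 0) _ _))

  ∑<-rotate : ∀ n f → f n ≡ f 0 → ∑< n (f ∘ suc) ≡ ∑< n f
  ∑<-rotate n f e = ℕₚ.+-cancelˡ-≡ (f 0) _ _
    (trans (∑<-last n f) (trans (ℕₚ.+-comm _ (f n)) (cong (_+ ∑< n f) e)))

  module _ (M : ℕ) where
    Periodic : (ℤ → ℕ) → Set
    Periodic g = ∀ x → g (x ℤ.+ + M) ≡ g x

    cycle : (ℤ → ℕ) → ℕ
    cycle g = ∑< M (g ∘ +_)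

    private
      swap : ∀ x a b → x ℤ.+ a ℤ.+ b ≡ x ℤ.+ b ℤ.+ a
      swap x a b = trans (ℤₚ.+-assoc x a b) (trans (cong (ℤ._+_ x) (ℤₚ.+-comm a b)) (sym (ℤₚ.+-assoc x b a)))

    periodic-shift : ∀ {g} k → Periodic g → Periodic (λ x → g (x ℤ.+ k))
    periodic-shift {g} k p x = trans (cong g (swap x (+ M) k)) (p (x ℤ.+ k))

    cycle-suc : ∀ g → Periodic g → cycle (λ x → g (x ℤ.+ 1ℤ)) ≡ cycle g
    cycle-suc g p = trans (∑<-cong M (λ i → cong (g ∘ +_) (ℕₚ.+-comm i 1)))
      (∑<-rotate M (g ∘ +_) (p (+ 0)))

    cycle-shift⁺ : ∀ n g → Periodic g → cycle (λ x → g (x ℤ.+ + n)) ≡ cycle g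
    cycle-shift⁺ zero g p = ∑<-cong M (λ i → cong g (ℤₚ.+-identityʳ (+ i)))
    cycle-shift⁺ (suc n) g p = trans
      (∑<-cong M (λ i → cong g (trans (cong (ℤ._+_ (+ i)) (ℤₚ.+-comm 1ℤ (+ n))) (sym (ℤₚ.+-assoc (+ i) (+ n) 1ℤ)))))
      (trans (cycle-shift⁺ n (λ x → g (x ℤ.+ 1ℤ)) (periodic-shift {g} 1ℤ p)) (cycle-suc g p))

    cycle-shift : ∀ k g → Periodic g → cycle (λ x → g (x ℤ.+ k)) ≡ cycle g
    cycle-shift (+ n) g p = cycle-shift⁺ n g p
    cycle-shift k@(-[1+ n ]) g p = trans
      (sym (cycle-shift⁺ (suc n) (λ x → g (x ℤ.+ k)) (periodic-shift {g} k p)))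
      (∑<-cong M (λ i → cong g (trans (ℤₚ.+-assoc (+ i) (+ suc n) k)
        (trans (cong (ℤ._+_ (+ i)) (ℤₚ.+-inverseʳ (+ suc n))) (ℤₚ.+-identityʳ (+ i))))))

  -- The difference of the remainders is a multiple of M and less than M in absolute value.
  remainder-unique : ∀ {M r r′} q q′ → r < M → r′ < M → + r ℤ.+ q ℤ.* + M ≡ + r′ ℤ.+ q′ ℤ.* + M → r ≡ r′
  remainder-unique {M} {r} {r′} q q′ r<M r′<M e = ℤₚ.+-injective (ℤₚ.i-j≡0⇒i≡j (+ r) (+ r′) (ℤₚ.∣i∣≡0⇒i≡0 d≡0))
    where
    d : ℕ
    d = ℤ.∣ + r ℤ.- + r′ ∣
    M∣d : M ℕ∣.∣ d
    M∣d = ℤ∣ₛ.∣⇒∣ᵤ (ℤ∣ₛ.divides (q′ ℤ.- q) (begin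
      + r ℤ.- + r′
        ≡⟨ solve 3 (λ a b u → a :- b := (a :+ u) :- (b :+ u)) refl (+ r) (+ r′) (q ℤ.* + M) ⟩
      (+ r ℤ.+ q ℤ.* + M) ℤ.- (+ r′ ℤ.+ q ℤ.* + M)
        ≡⟨ cong (ℤ._- (+ r′ ℤ.+ q ℤ.* + M)) e ⟩
      (+ r′ ℤ.+ q′ ℤ.* + M) ℤ.- (+ r′ ℤ.+ q ℤ.* + M)
        ≡⟨ solve 4 (λ b m u v → (b :+ v :* m) :- (b :+ u :* m) := (v :- u) :* m) refl (+ r′) (+ M) q q′ ⟩
      (q′ ℤ.- q) ℤ.* + M ∎))
      where
      open ℤ-Solver
      open ≡-Reasoning
    d<M : d < M
    d<M = subst (_< M) (cong ℤ.∣_∣ (sym (ℤₚ.m-n≡m⊖n r r′))) (bound (ℕₚ.≤-total r r′))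
      where
      bound : r ≤ r′ ⊎ r′ ≤ r → ℤ.∣ r ℤ.⊖ r′ ∣ < M
      bound (inj₁ p) = subst (_< M) (sym (ℤₚ.∣⊖∣-≤ p)) (ℕₚ.≤-<-trans (ℕₚ.m∸n≤m r′ r) r′<M)
      bound (inj₂ p) = subst (_< M) (trans (sym (ℤₚ.∣⊖∣-≤ p)) (ℤₚ.∣m⊖n∣≡∣n⊖m∣ r′ r)) (ℕₚ.≤-<-trans (ℕₚ.m∸n≤m r r′) r<M)
    d≡0 : d ≡ 0
    d≡0 with d ℕₚ.≟ 0
    ... | yes z = z
    ... | no n≢0 = ⊥-elim (ℕ∣.>⇒∤ {{ℕ.≢-nonZero n≢0}} d<M M∣d)

-- Discharging on the torus.

module Counting where
  import Data.Integer.Properties as ℤₚ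
  open LinearArithmetic
  open Configurations
  open UncoveredCells
  open Sums
  open import Algebra.Properties.AbelianGroup ℤₚ.+-0-abelianGroup using () renaming (∙-cancelʳ to +-cancelʳ)
  open import Data.Bool using (Bool; true; false; T; _xor_)
  import Data.Bool.Properties as Boolₚ
  open import Data.Empty using (⊥-elim)
  open import Data.Fin using (Fin; suc; toℕ; #_)
  import Data.Fin.Properties as Finₚ
  open import Data.Integer using (ℤ; +_; -[1+_]; _+_; _*_; -_; _-_; _≤_; 0ℤ; 1ℤ)
  open import Data.Integer.DivMod using (_/ℕ_; _%ℕ_; a≡a%ℕn+[a/ℕn]*n; n%ℕd<d)
  open import Data.Integer.Solver using () renaming (module +-*-Solver to ℤ-Solver)
  open import Data.List using (List; []; _∷_; map; length; allFin; cartesianProduct)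
  open import Data.List.Membership.Propositional using (_∈_; lose; find)
  open import Data.List.Membership.Propositional.Properties using (∈-cartesianProduct⁺; ∈-allFin; ∈-map⁺)
  open import Data.List.Relation.Unary.All as All using ([]; _∷_)
  open import Data.List.Relation.Unary.Any using (Any; here; there; any?)
  open import Data.List.Relation.Unary.Unique.Propositional using (Unique)
  open import Data.List.Relation.Unary.Unique.Propositional.Properties using (cartesianProduct⁺; allFin⁺)
  open import Data.List.Relation.Unary.AllPairs using ([]; _∷_)
  open import Data.Maybe using (Maybe; just; nothing)
  import Data.Maybe.Properties as Maybeₚ
  open import Data.Nat using (ℕ; suc)
  import Data.Nat as ℕ
  import Data.Nat.Properties as ℕₚ
  open import Data.Product using (_×_; _,_; proj₁; proj₂; ∃-syntax)
  open import Data.Product.Properties using () renaming (≡-dec to ×-≡-dec)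
  open import Data.Sum using (_⊎_; inj₁; inj₂; [_,_]′)
  open import Function using (_∘_)
  open import Function.Bundles using (Equivalence)
  open import Relation.Binary.PropositionalEquality
  open import Relation.Nullary using (¬_; Dec; yes; no)
  open import Relation.Nullary.Decidable using (_×-dec_; map′)

  open Configuration
  open At

  Code : Set
  Code = Bool × Fin 9

  δ : Code → Vector
  δ (c , i) = flip c (shift (config i))

  codes : List Code
  codes = cartesianProduct (false ∷ true ∷ []) (allFin 9)

  codes-unique : Unique codes
  codes-unique = cartesianProduct⁺ {xs = false ∷ true ∷ []} {ys = allFin 9} (((λ ()) ∷ []) ∷ [] ∷ []) (allFin⁺ 9)

  ∈-codes : ∀ k → k ∈ codes
  ∈-codes (false , i) = ∈-cartesianProduct⁺ {xs = false ∷ true ∷ []} (here refl) (∈-allFin i)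
  ∈-codes (true , i) = ∈-cartesianProduct⁺ {xs = false ∷ true ∷ []} (there (here refl)) (∈-allFin i)

  _≟ᶜ_ : (m n : Maybe Code) → Dec (m ≡ n)
  _≟ᶜ_ = Maybeₚ.≡-dec (×-≡-dec Boolₚ._≟_ Finₚ._≟_)

  +ᵥ-assoc : ∀ u v w → (u +ᵥ v) +ᵥ w ≡ u +ᵥ (v +ᵥ w)
  +ᵥ-assoc (a , b) (c , d) (e , f) = cong₂ _,_ (ℤₚ.+-assoc a c e) (ℤₚ.+-assoc b d f)

  +ᵥ-neg : ∀ u d → (u +ᵥ neg d) +ᵥ d ≡ u
  +ᵥ-neg (a , b) (c , d) = cong₂ _,_ (eq a c) (eq b d)
    where
    eq : ∀ a c → a - c + c ≡ a
    eq = solve 2 (λ a c → (a :- c) :+ c := a) refl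
      where open ℤ-Solver

  flip-injective : ∀ c {u v} → flip c u ≡ flip c v → u ≡ v
  flip-injective false e = e
  flip-injective true e = cong₂ _,_ (cong proj₁ e) (ℤₚ.neg-injective (cong proj₂ e))

  flip-sub : ∀ c d v → neg (flip c d) +ᵥ flip c v ≡ flip c (v +ᵥ neg d)
  flip-sub false (a , b) (x , y) = cong₂ _,_ (ℤₚ.+-comm (- a) x) (ℤₚ.+-comm (- b) y)
  flip-sub true (a , b) (x , y) = cong₂ _,_ (ℤₚ.+-comm (- a) x)
    (trans (ℤₚ.+-comm (- - b) (- y)) (sym (ℤₚ.neg-distrib-+ y (- b))))

  +ᵥ-cancel : ∀ w u v → u +ᵥ w ≡ v +ᵥ w → u ≡ v
  +ᵥ-cancel (a , b) u v e = cong₂ _,_ (+-cancelʳ a _ _ (cong proj₁ e)) (+-cancelʳ b _ _ (cong proj₂ e))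

  -- Both sides are the position of v, seen from the second cell, as an offset from the first cell;
  -- the two cells f − flip c d and f − flip c′ d′ have the common target f.
  change-cell : ∀ c c′ (f d d′ v : Vector) →
    (f +ᵥ neg (flip c d)) +ᵥ flip c (flip (c xor c′) v +ᵥ (d − flip (c xor c′) d′)) ≡ (f +ᵥ neg (flip c′ d′)) +ᵥ flip c′ v
  change-cell c c′ (f , g) (d , e) (d′ , e′) (x , y) = cases c c′
    where
    open ℤ-Solver
    first : ∀ f d d′ x → f - d + (x + (d - d′)) ≡ f - d′ + x
    first = solve 4 (λ f d d′ x → f :- d :+ (x :+ (d :- d′)) := f :- d′ :+ x) refl
    ++ : ∀ g e e′ y → g - - e + - (- y + (e - - e′)) ≡ g - e′ + y
    ++ = solve 4 (λ g e e′ y → g :- (:- e) :+ :- (:- y :+ (e :- (:- e′))) := g :- e′ :+ y) refl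
    +- : ∀ g e e′ y → g - - e + - (y + (e - e′)) ≡ g - - e′ + - y
    +- = solve 4 (λ g e e′ y → g :- (:- e) :+ :- (y :+ (e :- e′)) := g :- (:- e′) :+ :- y) refl
    -+ : ∀ g e e′ y → g - e + (- y + (e - - e′)) ≡ g - - e′ + - y
    -+ = solve 4 (λ g e e′ y → g :- e :+ (:- y :+ (e :- (:- e′))) := g :- (:- e′) :+ :- y) refl
    cases : ∀ c c′ → ((f , g) +ᵥ neg (flip c (d , e))) +ᵥ flip c (flip (c xor c′)
        (x , y) +ᵥ ((d , e) − flip (c xor c′) (d′ , e′)))
      ≡ ((f , g) +ᵥ neg (flip c′ (d′ , e′))) +ᵥ flip c′ (x , y)
    cases false false = cong₂ _,_ (first f d d′ x) (first g e e′ y)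
    cases false true = cong₂ _,_ (first f d d′ x) (-+ g e e′ y)
    cases true false = cong₂ _,_ (first f d d′ x) (++ g e e′ y)
    cases true true = cong₂ _,_ (first f d d′ x) (+- g e e′ y)

  -- The inverse change of frame: a position seen from the first cell, rewritten as seen from the
  -- second.
  change-back : ∀ c c′ (f d d′ v : Vector) →
    (f +ᵥ neg (flip c′ d′)) +ᵥ flip c′ (flip (c xor c′)
        (v +ᵥ neg (d − flip (c xor c′) d′))) ≡ (f +ᵥ neg (flip c d)) +ᵥ flip c v
  change-back c c′ (f , g) (d , e) (d′ , e′) (x , y) = cases c c′
    where
    open ℤ-Solver
    first : ∀ f d d′ x → f - d′ + (x - (d - d′)) ≡ f - d + x
    first = solve 4 (λ f d d′ x → f :- d′ :+ (x :- (d :- d′)) := f :- d :+ x) refl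
    ++ : ∀ g e e′ y → g - e′ + - (y - (e - - e′)) ≡ g - - e + - y
    ++ = solve 4 (λ g e e′ y → g :- e′ :+ :- (y :- (e :- (:- e′))) := g :- (:- e) :+ :- y) refl
    +- : ∀ g e e′ y → g - - e′ + - (y - (e - e′)) ≡ g - - e + - y
    +- = solve 4 (λ g e e′ y → g :- (:- e′) :+ :- (y :- (e :- e′)) := g :- (:- e) :+ :- y) refl
    -+ : ∀ g e e′ y → g - - e′ + - - (y - (e - - e′)) ≡ g - e + y
    -+ = solve 4 (λ g e e′ y → g :- (:- e′) :+ :- (:- (y :- (e :- (:- e′)))) := g :- e :+ y) refl
    cases : ∀ c c′ → ((f , g) +ᵥ neg (flip c′ (d′ , e′))) +ᵥ flip c′ (flip (c xor c′)
        ((x , y) +ᵥ neg ((d , e) − flip (c xor c′) (d′ , e′))))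
      ≡ ((f , g) +ᵥ neg (flip c (d , e))) +ᵥ flip c (x , y)
    cases false false = cong₂ _,_ (first f d d′ x) (first g e e′ y)
    cases false true = cong₂ _,_ (first f d d′ x) (-+ g e e′ y)
    cases true false = cong₂ _,_ (first f d d′ x) (++ g e e′ y)
    cases true true = cong₂ _,_ (first f d d′ x) (+- g e e′ y)

  same-shift : ∀ c c′ d d′ → d − flip (c xor c′) d′ ≡ (0ℤ , 0ℤ) → flip c d ≡ flip c′ d′
  same-shift c c′ (d , e) (d′ , e′) h = cases c c′ h
    where
    cases : ∀ c c′ → (d , e) − flip (c xor c′) (d′ , e′) ≡ (0ℤ , 0ℤ) → flip c (d , e) ≡ flip c′ (d′ , e′)
    fst : ∀ {a b : ℤ} → (d - d′ , a) ≡ (0ℤ , b) → d ≡ d′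
    fst h = ℤₚ.i-j≡0⇒i≡j d d′ (cong proj₁ h)
    cases false false h = cong₂ _,_ (fst h) (ℤₚ.i-j≡0⇒i≡j e e′ (cong proj₂ h))
    cases false true h = cong₂ _,_ (fst h) (ℤₚ.i-j≡0⇒i≡j e (- e′) (cong proj₂ h))
    cases true false h = cong₂ _,_ (fst h) (trans (cong -_ (ℤₚ.i-j≡0⇒i≡j e (- e′) (cong proj₂ h))) (ℤₚ.neg-involutive e′))
    cases true true h = cong₂ _,_ (fst h) (cong -_ (ℤₚ.i-j≡0⇒i≡j e e′ (cong proj₂ h)))

  -- Choice of a configuration at each uncovered cell, and the balance over a period.

  module Torus
    {σ : ℤ} (2≤σ : + 2 ≤ σ) {Tow : View} (Tow? : ∀ v → Dec (Tow v)) (supplied : ∀ v → Supplied σ Tow v)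
    (M N : ℕ) .{{_ : ℕ.NonZero M}} .{{_ : ℕ.NonZero N}}
    (periodic : ∀ k l x y → Tow (x , y) → Tow (x + k * + M , y + l * + N))
    (window : List Vector)
    (complete : ∀ x y → ⟦ covers p₁ ⟧ (env (σ ∷ x ∷ y ∷ [])) → (x , y) ∈ window)
    where

    view : Vector → View
    view e v = Tow (e +ᵥ v)

    recentre : ∀ r a b c d x y →
        ⟦ ball r (var 1 ⊝ (var 3 ⊕ var 5) , var 2 ⊝ (var 4 ⊕ var 6)) ⟧ (env (σ ∷ x ∷ y ∷ a ∷ b ∷ c ∷ d ∷ [])) →
      T (valid? (ball r (var 1 ⊝ (var 3 ⊕ var 5) , var 2 ⊝ (var 4 ⊕ var 6)) ⇒′
          ball r (var 1 ⊝ var 3 ⊝ var 5 , var 2 ⊝ var 4 ⊝ var 6))) →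
      ⟦ ball r (var 1 ⊝ var 3 ⊝ var 5 , var 2 ⊝ var 4 ⊝ var 6) ⟧ (env (σ ∷ x ∷ y ∷ a ∷ b ∷ c ∷ d ∷ []))
    recentre r a b c d x y h e = by (ball r (var 1 ⊝ (var 3 ⊕ var 5) , var 2 ⊝ (var 4 ⊕ var 6)) ⇒′
      ball r (var 1 ⊝ var 3 ⊝ var 5 , var 2 ⊝ var 4 ⊝ var 6)) (σ ∷ x ∷ y ∷ a ∷ b ∷ c ∷ d ∷ []) {e} h

    in-view : ∀ a b x y → Tow (x , y) → view (a , b) (x - a , y - b)
    in-view a b x y = subst Tow (sym (cong₂ _,_ (eq x a) (eq y b)))
      where
      eq : ∀ x a → a + (x - a) ≡ x
      eq = solve 2 (λ x a → a :+ (x :- a) := x) refl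
        where open ℤ-Solver

    view-supplied : ∀ e v → Supplied σ (view e) v
    view-supplied (a , b) (c , d) with supplied ((a , b) +ᵥ (c , d))
    ... | inj₁ (x , y , t , h) = inj₁ (x - a , y - b , in-view a b x y t , recentre (s ⊝ lit 1ℤ) a b c d x y h _)
    ... | inj₂ (x , y , x′ , y′ , t , t′ , n , h , h′) =
      inj₂ (x - a , y - b , x′ - a , y′ - b , in-view a b x y t , in-view a b x′ y′ t′ ,
        (λ (p , q) → n (+-cancelʳ (- a) x x′ p , +-cancelʳ (- b) y y′ q)) ,
        recentre s a b c d x y h _ , recentre s a b c d x′ y′ h′ _)

    Covered : Vector → Set
    Covered e = ∃[ x ] ∃[ y ] view e (x , y) × ⟦ covers p₁ ⟧ (env (σ ∷ x ∷ y ∷ []))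

    Doubled : Vector → Vector → Set
    Doubled d e = ∃[ x ] ∃[ y ] ∃[ x′ ] ∃[ y′ ] view e (x , y) × view e (x′ , y′) ×
      ⟦ doubly d p₁ p₂ ⟧ (env (σ ∷ x ∷ y ∷ x′ ∷ y′ ∷ []))

    Reach : Vector → Vector → Set
    Reach e (x , y) = view e (x , y) × ⟦ covers p₁ ⟧ (env (σ ∷ x ∷ y ∷ []))

    covered? : ∀ e → Dec (Covered e)
    covered? e = map′
      (λ w → let (v , _ , t , h) = find {P = Reach e} w in proj₁ v , proj₂ v , t , h)
      (λ (x , y , t , h) → lose {P = Reach e} (complete x y h) (t , h))
      (any? reach? window)
      where
      reach? : ∀ v → Dec (Reach e v)
      reach? (x , y) = Tow? (e +ᵥ (x , y)) ×-dec decide (covers p₁) (env (σ ∷ x ∷ y ∷ []))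

    window-at : ∀ d x y → ⟦ covers (p₁ ⊹ neg d) ⟧ (env (σ ∷ x ∷ y ∷ [])) → (x , y) ∈ map (_+ᵥ d) window
    window-at d x y h = subst (_∈ map (_+ᵥ d) window) (+ᵥ-neg (x , y) d) (∈-map⁺ (_+ᵥ d)
        (complete (x + proj₁ (neg d)) (y + proj₂ (neg d)) h))

    Reach₂ : Vector → Vector → Vector → Vector → Set
    Reach₂ d e (x , y) (x′ , y′) = view e (x , y) × view e (x′ , y′) × ⟦ doubly d p₁ p₂ ⟧ (env (σ ∷ x ∷ y ∷ x′ ∷ y′ ∷ []))

    doubled? : ∀ d e → Dec (Doubled d e)
    doubled? d e = map′
      (λ w → let (v , _ , w′) = find {P = λ v → Any (Reach₂ d e v) ws} w ; (v′ , _ , t , t′ , h) = find {P = Reach₂ d e v} w′ in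
        proj₁ v , proj₂ v , proj₁ v′ , proj₂ v′ , t , t′ , h)
      (λ (x , y , x′ , y′ , t , t′ , h@(c , c′ , _)) → lose {P = λ v → Any (Reach₂ d e v) ws} (window-at d x y c)
        (lose {P = Reach₂ d e (x , y)} (window-at d x′ y′ c′) (t , t′ , h)))
      (any? (λ v → any? (reach? v) ws) ws)
      where
      ws : List Vector
      ws = map (_+ᵥ d) window
      reach? : ∀ v v′ → Dec (Reach₂ d e v v′)
      reach? (x , y) (x′ , y′) = Tow? (e +ᵥ (x , y)) ×-dec Tow? (e +ᵥ (x′ , y′)) ×-dec
        decide (doubly d p₁ p₂) (env (σ ∷ x ∷ y ∷ x′ ∷ y′ ∷ []))

    outcome-at : ∀ e → ¬ Covered e → Outcome σ (view e)
    outcome-at e n = [ (λ l → false , # 0 , beside l) , (λ k → [ (λ r → false , # 1 , beside r) , (λ k′ →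
        resolve-hole record
        { 2≤σ = 2≤σ
        ; V? = λ v → Tow? (e +ᵥ v)
        ; supplied = view-supplied e
        ; uncovered = uncovered′
        ; no-left = λ x y x′ y′ t t′ h → k (x , y , x′ , y′ , t , t′ , h)
        ; no-right = λ x y x′ y′ t t′ h → k′ (x , y , x′ , y′ , t , t′ , h)
        }) ]′ (either (doubled? (1ℤ , 0ℤ) e))) ]′ (either (doubled? (-[1+ 0 ] , 0ℤ) e))
      where
      either : {A : Set} → Dec A → A ⊎ ¬ A
      either (yes a) = inj₁ a
      either (no ¬a) = inj₂ ¬a
      uncovered′ : Uncovered σ (view e)
      uncovered′ x y t h = n (x , y , t , h)
      beside : ∀ {d} → Doubled d e → At σ (view e) (configuration d p₁ p₂ [] (doubly d p₁ p₂) [])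
      beside (x , y , x′ , y′ , t , t′ , h) = at (env (σ ∷ x ∷ y ∷ x′ ∷ y′ ∷ [])) refl h (t ∷ t′ ∷ []) [] uncovered′

    Found : Code → Vector → Set
    Found (c , i) e = At σ (view e ∘ flip c) (config i)

    cov : Vector → ℕ
    cov f = ∑ window (λ v → indicator (Tow? (f +ᵥ v)))

    indicator-true : ∀ {v} → Tow v → indicator (Tow? v) ≡ 1
    indicator-true = indicator-yes (Tow? _)

    covered-cov : ∀ f → Covered f → 1 ℕ.≤ cov f
    covered-cov f (x , y , t , h) = subst (ℕ._≤ cov f) (indicator-true t)
      (∑-one (λ v → indicator (Tow? (f +ᵥ v))) (complete x y h))

    found-double : ∀ k f → Found k (f +ᵥ neg (δ k)) → 2 ℕ.≤ cov f
    found-double (c , i) f A = from-pair (double-at (config i) (double-valid i) 2≤σ A)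
      where
      d : Vector
      d = shift (config i)
      rel : Vector → Vector
      rel u = flip c (u +ᵥ neg d)
      seen : ∀ u → view (f +ᵥ neg (flip c d)) (flip c u) → Tow (f +ᵥ rel u)
      seen u = subst Tow (trans (+ᵥ-assoc f (neg (flip c d)) (flip c u)) (cong (f +ᵥ_) (flip-sub c d u)))
      listed : ∀ c u → Covering σ u → flip c u ∈ window
      listed false (x , y) h = complete x y h
      listed true (x , y) h = complete x (- y) (by (covers p₁ ⇒′ covers (flipₚ true p₁)) (σ ∷ x ∷ y ∷ []) h)
      from-pair : ∃[ u ] ∃[ v ] u ≢ v × view (f +ᵥ neg (flip c d)) (flip c u) × view (f +ᵥ neg (flip c d)) (flip c v) ×
        Covering σ (u +ᵥ neg d) × Covering σ (v +ᵥ neg d) → 2 ℕ.≤ cov f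
      from-pair (u , v , u≢v , t , t′ , h , h′) =
        subst (ℕ._≤ cov f) (cong₂ ℕ._+_ (indicator-true (seen u t)) (indicator-true (seen v t′)))
          (∑-two (λ v → indicator (Tow? (f +ᵥ v))) (λ e → u≢v (+ᵥ-cancel (neg d) u v (flip-injective c e)))
              (listed c (u +ᵥ neg d) h) (listed c (v +ᵥ neg d) h′))

    exclusive-≤ : ∀ f c i c′ j → toℕ i ℕ.≤ toℕ j → Found (c , i) (f +ᵥ neg (δ (c , i))) →
        Found (c′ , j) (f +ᵥ neg (δ (c′ , j))) →
      δ (c , i) ≡ δ (c′ , j)
    exclusive-≤ f c i c′ j i≤j A A′ =
      [ (λ j<i → ⊥-elim (ℕₚ.<⇒≱ (ℕₚ.<ᵇ⇒< (toℕ j) (toℕ i) j<i) i≤j))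
      , [ (λ e → same-shift c c′ d d′ (Relation.Nullary.Decidable.toWitness e))
        , (λ e → ⊥-elim (Exclusive.not-clashing {V = view (f +ᵥ neg (δ (c , i))) ∘ flip c} {V′ =
            view (f +ᵥ neg (δ (c′ , j))) ∘ flip c′}
            2≤σ b (config i) (config j)
            (λ v → subst Tow (sym (change-cell c c′ f d d′ v))) (λ v → subst Tow (sym (change-back c c′ f d d′ v)))
            A A′ (hint b (toℕ i) (toℕ j)) e)) ]′
        ∘ Equivalence.to (Boolₚ.T-∨ {same? b (config i) (config j)}) ]′
      (Equivalence.to (Boolₚ.T-∨ {toℕ j ℕ.<ᵇ toℕ i}) (table b i j))
      where
      b : Bool
      b = c xor c′
      d d′ : Vector
      d = shift (config i)
      d′ = shift (config j)

    exclusive : ∀ f k k′ → Found k (f +ᵥ neg (δ k)) → Found k′ (f +ᵥ neg (δ k′)) → δ k ≡ δ k′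
    exclusive f (c , i) (c′ , j) A A′ =
      [ (λ p → exclusive-≤ f c i c′ j p A A′) , (λ p → sym (exclusive-≤ f c′ j c i p A′ A)) ]′ (ℕₚ.≤-total (toℕ i)
          (toℕ j))

    rep : Vector → Vector
    rep (x , y) = + (x %ℕ M) , + (y %ℕ N)

    rep-invariant : ∀ k l x y → rep (x + k * + M , y + l * + N) ≡ rep (x , y)
    rep-invariant k l x y = cong₂ (λ a b → + a , + b) (invariant M x k) (invariant N y l)
      where
      invariant : ∀ n .{{_ : ℕ.NonZero n}} x k → (x + k * + n) %ℕ n ≡ x %ℕ n
      invariant n x k = remainder-unique ((x + k * + n) /ℕ n) (x /ℕ n + k) (n%ℕd<d (x + k * + n) n) (n%ℕd<d x n)
        (trans (sym (a≡a%ℕn+[a/ℕn]*n (x + k * + n) n))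
          (trans (cong (_+ k * + n) (a≡a%ℕn+[a/ℕn]*n x n))
            (solve 4 (λ r q k n → r :+ q :* n :+ k :* n := r :+ (q :+ k) :* n) refl (+ (x %ℕ n)) (x /ℕ n) k (+ n))))
        where open ℤ-Solver

    view-rep : ∀ e v → (view (rep e) v → view e v) × (view e v → view (rep e) v)
    view-rep (x , y) (a , b) =
      (λ t → subst Tow (cong₂ _,_ (there′ M x a) (there′ N y b)) (periodic (x /ℕ M) (y /ℕ N) _ _ t)) ,
      (λ t → subst Tow (cong₂ _,_ (back M x a) (back N y b)) (periodic (- (x /ℕ M)) (- (y /ℕ N)) _ _ t))
      where
      open ℤ-Solver
      there′ : ∀ n .{{_ : ℕ.NonZero n}} x a → + (x %ℕ n) + a + x /ℕ n * + n ≡ x + a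
      there′ n x a = trans (solve 3 (λ r a q → r :+ a :+ q := r :+ q :+ a) refl (+ (x %ℕ n)) a (x /ℕ n * + n))
        (cong (_+ a) (sym (a≡a%ℕn+[a/ℕn]*n x n)))
      back : ∀ n .{{_ : ℕ.NonZero n}} x a → x + a + - (x /ℕ n) * + n ≡ + (x %ℕ n) + a
      back n x a = trans (cong (λ z → z + a + - (x /ℕ n) * + n) (a≡a%ℕn+[a/ℕn]*n x n))
        (solve 4 (λ r q n a → r :+ q :* n :+ a :+ (:- q) :* n := r :+ a) refl (+ (x %ℕ n)) (x /ℕ n) (+ n) a)

    select : ∀ e → Dec (Covered e) → Maybe Code
    select e (yes _) = nothing
    select e (no n) = let (c , i , _) = outcome-at e n in just (c , i)

    -- Chosen at a representative of e modulo the periods, so that choice is periodic.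
    choice : Vector → Maybe Code
    choice e = select (rep e) (covered? (rep e))

    choice-found : ∀ e k → choice e ≡ just k → Found k e
    choice-found e k = found (covered? (rep e))
      where
      found : ∀ d → select (rep e) d ≡ just k → Found k e
      found (no n) refl = at-map (λ v → proj₁ (view-rep e _)) (λ v →
          proj₂ (view-rep e _)) (proj₂ (proj₂ (outcome-at (rep e) n)))

    choice-covered : ∀ e → choice e ≡ nothing → Covered e
    choice-covered e = covered (covered? (rep e))
      where
      covered : ∀ d → select (rep e) d ≡ nothing → Covered e
      covered (yes (x , y , t , h)) _ = x , y , proj₁ (view-rep e (x , y)) t , h

    chosen? : ∀ k e → Dec (choice e ≡ just k)
    chosen? k e = choice e ≟ᶜ just k

    -- A cell that chose the code k sends one unit along δ k, so the unit arriving at f left from f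
    -- - δ k.
    incoming outgoing : Code → Vector → ℕ
    outgoing k e = indicator (chosen? k e)
    incoming k f = outgoing k (f +ᵥ neg (δ k))

    -- By `exclusive`, two codes delivering to f have the same displacement, hence the same source;
    -- a source makes one choice, so the codes agree. Thus at most one unit arrives, and if one
    -- does, f is doubly covered.
    incoming-bound : ∀ f → ∑ codes (λ k → incoming k f) ≡ 0 ⊎ suc (∑ codes (λ k → incoming k f)) ℕ.≤ cov f
    incoming-bound f = [ inj₁ , (λ ((k , e) , h) → inj₂ (subst (λ z → suc z ℕ.≤ cov f) (sym h)
        (found-double k f (choice-found (f +ᵥ neg (δ k)) k e)))) ]′
      (∑-at-most-one (λ k → chosen? k (f +ᵥ neg (δ k))) same codes-unique)
      where
      same : ∀ {k k′} → choice (f +ᵥ neg (δ k)) ≡ just k → choice (f +ᵥ neg (δ k′)) ≡ just k′ → k ≡ k′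
      same {k} {k′} e e′ = Maybeₚ.just-injective (trans (sym e)
        (trans (cong (λ d → choice (f +ᵥ neg d)) (exclusive f k k′ (choice-found (f +ᵥ neg (δ k)) k e)
            (choice-found (f +ᵥ neg (δ k′)) k′ e′))) e′))

    outgoing-bound : ∀ f → 1 ℕ.≤ cov f ℕ.+ ∑ codes (λ k → outgoing k f)
    outgoing-bound f = bound (choice f) refl
      where
      bound : ∀ m → choice f ≡ m → 1 ℕ.≤ cov f ℕ.+ ∑ codes (λ k → outgoing k f)
      bound nothing e = ℕₚ.≤-trans (covered-cov f (choice-covered f e)) (ℕₚ.m≤m+n _ _)
      bound (just k) e = ℕₚ.≤-trans (subst (ℕ._≤ ∑ codes (λ k → outgoing k f)) (indicator-yes (chosen? k f) e)
        (∑-one (λ k → outgoing k f) (∈-codes k))) (ℕₚ.m≤n+m _ (cov f))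

    -- The discharging inequality. A cell that receives a unit has coverage at least 2; one that
    -- receives none is covered or sends a unit itself.
    local : ∀ f → suc (∑ codes (λ k → incoming k f)) ℕ.≤ cov f ℕ.+ ∑ codes (λ k → outgoing k f)
    local f = [ (λ z → subst (λ z → suc z ℕ.≤ cov f ℕ.+ ∑ codes (λ k → outgoing k f)) (sym z) (outgoing-bound f))
              , (λ h → ℕₚ.≤-trans h (ℕₚ.m≤m+n _ _)) ]′ (incoming-bound f)

    total : (Vector → ℕ) → ℕ
    total g = cycle M (λ x → cycle N (λ y → g (x , y)))

    Invariant : (Vector → ℕ) → Set
    Invariant g = ∀ k l x y → g (x + k * + M , y + l * + N) ≡ g (x , y)

    total-shift : ∀ v g → Invariant g → total (λ u → g (u +ᵥ v)) ≡ total g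
    total-shift (a , b) g inv = trans
      (∑<-cong M (λ i → cycle-shift N b (λ y → g (+ i + a , y)) (λ y → step₂ (+ i + a) y)))
      (cycle-shift M a (λ x → cycle N (λ y → g (x , y))) (λ x → ∑<-cong N (λ j → step₁ x (+ j))))
      where
      step₁ : ∀ x y → g (x + + M , y) ≡ g (x , y)
      step₁ x y = trans (cong g (sym (cong₂ _,_ (cong (_+_ x) (ℤₚ.*-identityˡ (+ M)))
        (trans (cong (_+_ y) (ℤₚ.*-zeroˡ (+ N))) (ℤₚ.+-identityʳ y))))) (inv 1ℤ 0ℤ x y)
      step₂ : ∀ x y → g (x , y + + N) ≡ g (x , y)
      step₂ x y = trans (cong g (sym (cong₂ _,_ (trans (cong (_+_ x) (ℤₚ.*-zeroˡ (+ M))) (ℤₚ.+-identityʳ x))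
        (cong (_+_ y) (ℤₚ.*-identityˡ (+ N)))))) (inv 0ℤ 1ℤ x y)

    total-mono : ∀ {g h} → (∀ v → g v ℕ.≤ h v) → total g ℕ.≤ total h
    total-mono e = ∑<-mono M (λ i → ∑<-mono N (λ j → e (+ i , + j)))

    total-+ : ∀ g h → total (λ v → g v ℕ.+ h v) ≡ total g ℕ.+ total h
    total-+ g h = trans (∑<-cong M (λ i → ∑<-+ N (λ j → g (+ i , + j)) (λ j → h (+ i , + j)))) (∑<-+ M _ _)

    total-∑ : {A : Set} (xs : List A) (g : A → Vector → ℕ) → total (λ v → ∑ xs (λ x → g x v)) ≡ ∑ xs (λ x → total (g x))
    total-∑ xs g = trans (∑<-cong M (λ i → ∑<-∑ xs N (λ x j → g x (+ i , + j)))) (∑<-∑ xs M _)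

    total-one : total (λ _ → 1) ≡ M ℕ.* N
    total-one = trans (∑<-cong M (λ _ → trans (∑<-const N 1) (ℕₚ.*-identityʳ N))) (∑<-const M N)

    tower-count : ℕ
    tower-count = total (λ v → indicator (Tow? v))

    tower-invariant : Invariant (λ v → indicator (Tow? v))
    tower-invariant k l x y = indicator-⇔ (Tow? _) (Tow? _)
      (λ t → subst Tow (cong₂ _,_ (cancel x k (+ M)) (cancel y l (+ N))) (periodic (- k) (- l) _ _ t))
      (periodic k l x y)
      where
      open ℤ-Solver
      cancel : ∀ x k n → x + k * n + - k * n ≡ x
      cancel = solve 3 (λ x k n → x :+ k :* n :+ (:- k) :* n := x) refl

    -- For each code separately, receiving is sending translated by a fixed vector, and the sum over
    -- a period does not see translations.
    balanced : total (λ f → ∑ codes (λ k → incoming k f)) ≡ total (λ f → ∑ codes (λ k → outgoing k f))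
    balanced = trans (total-∑ codes incoming) (trans
      (∑-cong codes (λ k → total-shift (neg (δ k)) (outgoing k) (λ m n x y →
        cong (λ e → indicator (select e (covered? e) ≟ᶜ just k)) (rep-invariant m n x y))))
      (sym (total-∑ codes outgoing)))

    -- Summing `local` over a period cancels the flow of units; in the total coverage each tower is
    -- counted once for each offset in `window`.
    area≤ : M ℕ.* N ℕ.≤ length window ℕ.* tower-count
    area≤ = ℕₚ.≤-trans (ℕₚ.+-cancelʳ-≤ flow _ _ (begin
        M ℕ.* N ℕ.+ flow
          ≡⟨ cong₂ ℕ._+_ (sym total-one) (sym balanced) ⟩
        total (λ _ → 1) ℕ.+ total (λ f → ∑ codes (λ k → incoming k f))
          ≡⟨ total-+ (λ _ → 1) (λ f → ∑ codes (λ k → incoming k f)) ⟨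
        total (λ f → suc (∑ codes (λ k → incoming k f)))
          ≤⟨ total-mono local ⟩
        total (λ f → cov f ℕ.+ ∑ codes (λ k → outgoing k f))
          ≡⟨ total-+ cov (λ f → ∑ codes (λ k → outgoing k f)) ⟩
        total cov ℕ.+ flow ∎))
      (begin
        total cov
          ≡⟨ total-∑ window (λ v f → indicator (Tow? (f +ᵥ v))) ⟩
        ∑ window (λ v → total (λ f → indicator (Tow? (f +ᵥ v))))
          ≤⟨ ∑-const-≤ window _ tower-count (λ v → ℕₚ.≤-reflexive (total-shift v (λ u →
              indicator (Tow? u)) tower-invariant)) ⟩
        length window ℕ.* tower-count ∎)
      where
      open ℕₚ.≤-Reasoning
      flow : ℕ
      flow = total (λ f → ∑ codes (λ k → outgoing k f))

-- From the grid to the periodic plane.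

module Unfold where
  open LinearArithmetic
  open Configurations
  open UncoveredCells using (Supplied; near; inside)
  open Sums
  open Counting using (module Torus)
  open import Data.Empty using (⊥-elim)
  open import Data.Fin using (Fin; toℕ; fromℕ<)
  import Data.Fin.Properties as Finₚ
  open import Data.Integer using (ℤ; +_; _+_; _*_; -_; _-_; _≤_; _<_; +≤+; 0ℤ; 1ℤ)
  open import Data.Integer.DivMod using (_/ℕ_; _%ℕ_; a≡a%ℕn+[a/ℕn]*n; n%ℕd<d)
  open import Data.Integer.Divisibility.Signed using (_∣_; divides; _∣?_; ∣m∣n⇒∣m+n; ∣m+n∣n⇒∣m; ∣⇒∣ᵤ; ∣n⇒∣m*n; ∣-refl)
  import Data.Integer.Properties as ℤₚ
  open import Data.Integer.Solver using () renaming (module +-*-Solver to ℤ-Solver)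
  open import Data.List using (List; []; _∷_; map; length; cartesianProduct; upTo)
  import Data.List.Properties as Listₚ
  open import Data.List.Membership.Propositional using (_∈_; lose; find)
  open import Data.List.Membership.Propositional.Properties using (∈-cartesianProduct⁺; ∈-map⁺; ∈-upTo⁺)
  open import Data.List.Relation.Unary.All as All using (All; []; _∷_)
  open import Data.List.Relation.Unary.AllPairs using ([]; _∷_)
  open import Data.List.Relation.Unary.Any using (Any; here; there; any?)
  open import Data.List.Relation.Unary.Unique.Propositional using (Unique)
  open import Data.Nat using (ℕ; zero; suc; _∸_; _^_; z≤n; s≤s) renaming (∣_-_∣ to gap)
  import Data.Nat as ℕ
  import Data.Nat.Divisibility as ℕ∣
  import Data.Nat.Properties as ℕₚ
  open import Data.Nat.Solver using () renaming (module +-*-Solver to ℕ-Solver)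
  open import Data.Product using (_×_; _,_; proj₁; proj₂; ∃-syntax)
  open import Data.Sum using (_⊎_; inj₁; inj₂; [_,_]′)
  open import Function using (_∘_)
  open import Relation.Binary.PropositionalEquality
  open import Relation.Nullary using (Dec; yes; no)
  open import Relation.Nullary.Decidable using (_×-dec_; _⊎-dec_)

  ℓ¹ : ∀ {m n} → GridV m n → GridV m n → ℕ
  ℓ¹ (i , j) (i′ , j′) = gap (toℕ i) (toℕ i′) ℕ.+ gap (toℕ j) (toℕ j′)

  -- Each step changes one coordinate by 1, so by the triangle inequality it adds at most 1.
  walk-ℓ¹ : ∀ {m n k} {u v : GridV m n} → Walk k u v → ℓ¹ u v ℕ.≤ k
  walk-ℓ¹ {u = i , j} here = ℕₚ.≤-reflexive (cong₂ ℕ._+_ (ℕₚ.∣n-n∣≡0 (toℕ i)) (ℕₚ.∣n-n∣≡0 (toℕ j)))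
  walk-ℓ¹ {k = suc k} {i , j} (step {w = a , b} w (inj₁ (refl , e))) = begin
      gap (toℕ i) (toℕ a) ℕ.+ gap (toℕ j) (toℕ _)
        ≤⟨ ℕₚ.+-monoʳ-≤ (gap (toℕ i) (toℕ a)) (ℕₚ.∣-∣-triangle (toℕ j) (toℕ b) _) ⟩
      gap (toℕ i) (toℕ a) ℕ.+ (gap (toℕ j) (toℕ b) ℕ.+ gap (toℕ b) (toℕ _))
        ≡⟨ cong (λ z → gap (toℕ i) (toℕ a) ℕ.+ (gap (toℕ j) (toℕ b) ℕ.+ z)) e ⟩
      gap (toℕ i) (toℕ a) ℕ.+ (gap (toℕ j) (toℕ b) ℕ.+ 1)
        ≡⟨ solve 2 (λ p q → p :+ (q :+ con 1) := con 1 :+ (p :+ q)) refl (gap (toℕ i) (toℕ a)) (gap (toℕ j) (toℕ b)) ⟩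
      suc (gap (toℕ i) (toℕ a) ℕ.+ gap (toℕ j) (toℕ b))
        ≤⟨ s≤s (walk-ℓ¹ w) ⟩
      suc k ∎
    where
    open ℕₚ.≤-Reasoning
    open ℕ-Solver
  walk-ℓ¹ {k = suc k} {i , j} (step {w = a , b} w (inj₂ (refl , e))) = begin
      gap (toℕ i) (toℕ _) ℕ.+ gap (toℕ j) (toℕ b)
        ≤⟨ ℕₚ.+-monoˡ-≤ (gap (toℕ j) (toℕ b)) (ℕₚ.∣-∣-triangle (toℕ i) (toℕ a) _) ⟩
      gap (toℕ i) (toℕ a) ℕ.+ gap (toℕ a) (toℕ _) ℕ.+ gap (toℕ j) (toℕ b)
        ≡⟨ cong (λ z → gap (toℕ i) (toℕ a) ℕ.+ z ℕ.+ gap (toℕ j) (toℕ b)) e ⟩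
      gap (toℕ i) (toℕ a) ℕ.+ 1 ℕ.+ gap (toℕ j) (toℕ b)
        ≡⟨ solve 2 (λ p q → p :+ con 1 :+ q := con 1 :+ (p :+ q)) refl (gap (toℕ i) (toℕ a)) (gap (toℕ j) (toℕ b)) ⟩
      suc (gap (toℕ i) (toℕ a) ℕ.+ gap (toℕ j) (toℕ b))
        ≤⟨ s≤s (walk-ℓ¹ w) ⟩
      suc k ∎
    where
    open ℕₚ.≤-Reasoning
    open ℕ-Solver

  module _ {m n : ℕ} (d : GridV m n → GridV m n → ℕ) (t : ℕ) (v : GridV m n) where
    some-signal : ∀ Ts → 1 ℕ.≤ totalSig d t Ts v → ∃[ T ] T ∈ Ts × 1 ℕ.≤ sig d t T v
    some-signal (T ∷ Ts) h with sig d t T v in e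
    ... | zero = let (T′ , p , h′) = some-signal Ts h in T′ , there p , h′
    ... | suc k = T , here refl , subst (1 ℕ.≤_) (sym e) (s≤s z≤n)

    two-signals : ∀ {Ts} → Unique Ts → 2 ℕ.≤ totalSig d t Ts v →
      (∃[ T ] T ∈ Ts × 2 ℕ.≤ sig d t T v) ⊎
      (∃[ T ] ∃[ T′ ] T ∈ Ts × T′ ∈ Ts × T ≢ T′ × 1 ℕ.≤ sig d t T v × 1 ℕ.≤ sig d t T′ v)
    two-signals {T ∷ Ts} (T∉ ∷ u) h with sig d t T v in e
    ... | zero = [ (λ (T′ , p , h′) → inj₁ (T′ , there p , h′))
                 , (λ (T₁ , T₂ , p , q , r) → inj₂ (T₁ , T₂ , there p , there q , r)) ]′ (two-signals u h)
    ... | suc (suc k) = inj₁ (T , here refl , subst (2 ℕ.≤_) (sym e) (s≤s (s≤s z≤n)))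
    ... | suc zero = let (T′ , p , h′) = some-signal Ts (ℕₚ.≤-pred h) in
      inj₂ (T , T′ , here refl , there p , All.lookup T∉ p , subst (1 ℕ.≤_) (sym e) (s≤s z≤n) , h′)

  -- x is a copy of a under the reflections generating the 2m-periodic unfolding of {0, …, m − 1}.
  Copy : ℕ → ℤ → ℕ → Set
  Copy m x a = + (2 ℕ.* m) ∣ x - + a ⊎ + (2 ℕ.* m) ∣ x + + suc a

  copy? : ∀ m x a → Dec (Copy m x a)
  copy? m x a = (+ (2 ℕ.* m) ∣? x - + a) ⊎-dec (+ (2 ℕ.* m) ∣? x + + suc a)

  copy-periodic : ∀ m k x a → Copy m x a → Copy m (x + k * + (2 ℕ.* m)) a
  copy-periodic m k x a = [ inj₁ ∘ move (- + a) , inj₂ ∘ move (+ suc a) ]′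
    where
    move : ∀ b → + (2 ℕ.* m) ∣ x + b → + (2 ℕ.* m) ∣ x + k * + (2 ℕ.* m) + b
    move b h = subst (+ (2 ℕ.* m) ∣_) (solve 3 (λ x b z → x :+ b :+ z := x :+ z :+ b) refl x b (k * + (2 ℕ.* m)))
      (∣m∣n⇒∣m+n h (∣n⇒∣m*n k ∣-refl))
      where open ℤ-Solver

  -- Each of the two congruences defining `Copy` has one solution per period.
  copies : ∀ m → m ≢ 0 → ∀ a → cycle (2 ℕ.* m) (λ x → indicator (copy? m x a)) ℕ.≤ 2
  copies m m≢0 a = begin
      cycle M (λ x → indicator (copy? m x a))
        ≤⟨ ∑<-mono M (λ i → split (+ i)) ⟩
      ∑< M (λ i → multiple (+ i + - + a) ℕ.+ multiple (+ i + + suc a))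
        ≡⟨ ∑<-+ M _ _ ⟩
      cycle M (λ x → multiple (x + - + a)) ℕ.+ cycle M (λ x → multiple (x + + suc a))
        ≡⟨ cong₂ ℕ._+_ (cycle-shift M (- + a) multiple multiple-periodic)
            (cycle-shift M (+ suc a) multiple multiple-periodic) ⟩
      cycle M multiple ℕ.+ cycle M multiple
        ≤⟨ ℕₚ.+-mono-≤ once once ⟩
      2 ∎
    where
    open ℕₚ.≤-Reasoning
    M : ℕ
    M = 2 ℕ.* m
    multiple : ℤ → ℕ
    multiple x = indicator (+ M ∣? x)
    multiple-periodic : Periodic M multiple
    multiple-periodic x = indicator-⇔ (+ M ∣? (x + + M)) (+ M ∣? x) (λ h → ∣m+n∣n⇒∣m h ∣-refl) (λ h → ∣m∣n⇒∣m+n h ∣-refl)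
    split : ∀ x → indicator (copy? m x a) ℕ.≤ multiple (x - + a) ℕ.+ multiple (x + + suc a)
    split x with + M ∣? x - + a | + M ∣? x + + suc a
    ... | yes _ | _ = s≤s z≤n
    ... | no _ | yes _ = s≤s z≤n
    ... | no _ | no _ = z≤n
    later : ∀ k i → i ℕ.+ k ℕ.< M → ∑< k (λ j → multiple (+ suc (i ℕ.+ j))) ≡ 0
    later zero i h = refl
    later (suc k) i h = cong₂ ℕ._+_ none
      (trans (∑<-cong k (λ j → cong (λ z → multiple (+ suc z)) (ℕₚ.+-suc i j))) (later k (suc i) (subst (ℕ._< M)
          (ℕₚ.+-suc i k) h)))
      where
      none : multiple (+ suc (i ℕ.+ 0)) ≡ 0
      none with + M ∣? + suc (i ℕ.+ 0)
      ... | no _ = refl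
      ... | yes p = ⊥-elim (ℕ∣.>⇒∤ (ℕₚ.≤-<-trans (subst (ℕ._≤ i ℕ.+ suc k) (sym (cong suc (ℕₚ.+-identityʳ i)))
        (subst (ℕ._≤ i ℕ.+ suc k) (ℕₚ.+-comm i 1) (ℕₚ.+-monoʳ-≤ i (s≤s z≤n)))) h) (∣⇒∣ᵤ p))
    once : cycle M multiple ℕ.≤ 1
    once = first M refl
      where
      first : ∀ K → K ≡ M → ∑< K (multiple ∘ +_) ℕ.≤ 1
      first zero e = z≤n
      first (suc K) e = ℕₚ.≤-trans (ℕₚ.≤-reflexive (cong (multiple (+ 0) ℕ.+_)
        (later K 0 (subst (K ℕ.<_) e ℕₚ.≤-refl)))) (subst (ℕ._≤ 1) (sym (ℕₚ.+-identityʳ _)) (bound (+ M ∣? + 0)))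
        where
        bound : ∀ {A : Set} (p : Dec A) → indicator p ℕ.≤ 1
        bound (yes _) = ℕₚ.≤-refl
        bound (no _) = z≤n

  -- The vertex i under x, and the copy of each a lying in the same reflected copy of {0, …, m − 1} as x.
  record Unfolded (m : ℕ) (x : ℤ) : Set where
    field
      base     : Fin m
      lift     : ℕ → ℤ
      is-copy  : ∀ a → Copy m (lift a) a
      distance : ∀ a → lift a - x ≡ + a - + toℕ base ⊎ lift a - x ≡ + toℕ base - + a
      injective : ∀ {a b} → lift a ≡ lift b → a ≡ b

  unfold : ∀ m x → m ≢ 0 → Unfolded m x
  unfold m x m≢0 with (x %ℕ (2 ℕ.* m)) {{nz}} | n%ℕd<d x (2 ℕ.* m) {{nz}} | (x /ℕ (2 ℕ.* m)) {{nz}} | a≡a%ℕn+[a/ℕn]*n x (2 ℕ.* m) {{nz}}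
    where
    nz : ℕ.NonZero (2 ℕ.* m)
    nz = ℕₚ.m*n≢0 2 m {{_}} {{ℕ.≢-nonZero m≢0}}
  ... | r | r<2m | q | e with r ℕₚ.<? m
  ...   | yes r<m = record
    { base = fromℕ< r<m
    ; lift = λ a → + a + P
    ; is-copy = λ a → inj₁ (divides q (solve 2 (λ a p → a :+ p :- a := p) refl (+ a) P))
    ; distance = λ a → inj₁ (trans (cong (_-_ (+ a + P)) e)
        (trans (solve 3 (λ a r p → a :+ p :- (r :+ p) := a :- r) refl (+ a) (+ r) P)
          (cong (λ z → + a - + z) (sym (Finₚ.toℕ-fromℕ< r<m)))))
    ; injective = λ {a} {b} h → ℤₚ.+-injective (trans (solve 2 (λ a p → a := a :+ p :- p) refl (+ a) P)
        (trans (cong (_- P) h) (solve 2 (λ a p → a :+ p :- p := a) refl (+ b) P)))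
    }
    where
    open ℤ-Solver
    P : ℤ
    P = q * + (2 ℕ.* m)
  -- Here x lies in a reflected copy: the residue r is the mirror image of 2m - 1 - r, and the same
  -- reflection takes a to P - 1 - a.
  ...   | no r≮m = record
    { base = fromℕ< i<m
    ; lift = λ a → P - + suc a
    ; is-copy = λ a → inj₂ (divides (q + 1ℤ) (trans (solve 2 (λ p a → p :- a :+ a := p) refl P (+ suc a))
        (solve 2 (λ q n → q :* n :+ n := (q :+ con 1ℤ) :* n) refl q (+ (2 ℕ.* m)))))
    ; distance = λ a → inj₂ (trans (cong (_-_ (P - + suc a)) e)
        (trans (solve 4 (λ a r q n → q :+ n :- (con 1ℤ :+ a) :- (r :+ q) := n :- (con 1ℤ :+ r) :- a) refl (+ a)
            (+ r) (q * + (2 ℕ.* m)) (+ (2 ℕ.* m)))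
          (cong (_- + a) (trans (sym i≡) (cong +_ (sym (Finₚ.toℕ-fromℕ< i<m)))))))
    ; injective = λ {a} {b} h → ℕₚ.suc-injective (ℤₚ.+-injective (trans (solve 2 (λ a p →
        a := p :- (p :- a)) refl (+ suc a) P)
        (trans (cong (_-_ P) h) (solve 2 (λ a p → p :- (p :- a) := a) refl (+ suc b) P))))
    }
    where
    open ℤ-Solver
    P : ℤ
    P = q * + (2 ℕ.* m) + + (2 ℕ.* m)
    i : ℕ
    i = 2 ℕ.* m ∸ suc r
    i≡ : + i ≡ + (2 ℕ.* m) - + suc r
    i≡ = sym (trans (ℤₚ.m-n≡m⊖n (2 ℕ.* m) (suc r)) (ℤₚ.⊖-≥ r<2m))
    i<m : i ℕ.< m
    i<m = ℕₚ.+-cancelʳ-< r i m (begin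
        suc (i ℕ.+ r)  ≡⟨ ℕₚ.+-suc i r ⟨
        i ℕ.+ suc r    ≡⟨ ℕₚ.m∸n+n≡m r<2m ⟩
        2 ℕ.* m        ≡⟨ cong (m ℕ.+_) (ℕₚ.+-identityʳ m) ⟩
        m ℕ.+ m        ≤⟨ ℕₚ.+-monoʳ-≤ m (ℕₚ.≮⇒≥ r≮m) ⟩
        m ℕ.+ r        ∎)
      where open ℕₚ.≤-Reasoning

  -- Here x + y = 1 - s + 2i + ε and x - y = 1 - s + 2j + ε. Both run through the 2s values from 1 -
  -- s to s with equal parity, whence the 2s² in the theorem.
  cell : ℕ → (ℕ × ℕ) × ℕ → Vector
  cell s ((i , j) , ε) = 1ℤ - + s + + i + + j + + ε , + i - + j

  indices : ℕ → List ((ℕ × ℕ) × ℕ)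
  indices s = cartesianProduct (cartesianProduct (upTo s) (upTo s)) (upTo 2)

  window : ℕ → List Vector
  window s = map (cell s) (indices s)

  length-product : ∀ {A B : Set} (xs : List A) (ys : List B) → length (cartesianProduct xs ys) ≡ length xs ℕ.* length ys
  length-product [] ys = refl
  length-product (x ∷ xs) ys = trans (Listₚ.length-++ (map (x ,_) ys))
    (cong₂ ℕ._+_ (Listₚ.length-map (x ,_) ys) (length-product xs ys))

  length-window : ∀ s → length (window s) ≡ s ℕ.* s ℕ.* 2
  length-window s = trans (Listₚ.length-map (cell s) (indices s))
      (trans (length-product (cartesianProduct (upTo s) (upTo s)) (upTo 2))
    (cong (ℕ._* 2) (trans (length-product (upTo s) (upTo s)) (cong₂ ℕ._*_ (Listₚ.length-upTo s) (Listₚ.length-upTo s)))))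

  natural : ∀ {z n} → 0ℤ ≤ z → z < + n → ∃[ k ] z ≡ + k × k ℕ.< n
  natural {+ k} _ (Data.Integer.+<+ h) = k , refl , h

  -- Halving x + y + s − 1 and x − y + s − 1, which have the same parity ε, gives the coordinates i and j of a cell.
  window-complete : ∀ s x y → Covering (+ s) (x , y) → (x , y) ∈ window s
  window-complete s x y h = listed (natural (proj₁ facts) (ℤₚ.suc[i]≤j⇒i<j (proj₁ (proj₂ facts))))
      (natural (proj₁ (proj₂ (proj₂ facts))) (ℤₚ.suc[i]≤j⇒i<j (proj₁ (proj₂ (proj₂ (proj₂ facts))))))
      (proj₂ (proj₂ (proj₂ (proj₂ facts))))
    where
    u w : ℤ
    u = x + y + + s - 1ℤ
    w = x - y + + s - 1ℤ
    euclid : ∀ z → z ≡ + (z %ℕ 2) + (z /ℕ 2 + z /ℕ 2)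
    euclid z = trans (a≡a%ℕn+[a/ℕn]*n z 2)
      (cong (_+_ (+ (z %ℕ 2))) (solve 1 (λ q → q :* con (+ 2) := q :+ q) refl (z /ℕ 2)))
      where open ℤ-Solver
    bit : ∀ z → + (z %ℕ 2) ≤ 1ℤ
    bit z = +≤+ (ℕₚ.≤-pred (n%ℕd<d z 2))
    i j ε ε′ : Expr
    i = var 3
    j = var 4
    ε = var 5
    ε′ = var 6
    facts = by (covers p₁ ⇒′ var 1 ⊕ var 2 ⊕ s′ ⊝ lit 1ℤ ≐ ε ⊕ (i ⊕ i) ⇒′ var 1 ⊝ var 2 ⊕ s′ ⊝ lit 1ℤ ≐ ε′ ⊕ (j ⊕ j) ⇒′
        lit 0ℤ ≼ ε ⇒′ ε ≼ lit 1ℤ ⇒′ lit 0ℤ ≼ ε′ ⇒′ ε′ ≼ lit 1ℤ ⇒′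
        lit 0ℤ ≼ i ∧′ lit 1ℤ ⊕ i ≼ s′ ∧′ lit 0ℤ ≼ j ∧′ lit 1ℤ ⊕ j ≼ s′ ∧′
        lit 1ℤ ⊝ s′ ⊕ i ⊕ j ⊕ ε ≐ var 1 ∧′ i ⊝ j ≐ var 2)
      (+ s ∷ x ∷ y ∷ u /ℕ 2 ∷ w /ℕ 2 ∷ + (u %ℕ 2) ∷ + (w %ℕ 2) ∷ []) h (euclid u) (euclid w)
      (+≤+ z≤n) (bit u) (+≤+ z≤n) (bit w)
      where
      s′ : Expr
      s′ = var 0
    listed : ∃[ k ] u /ℕ 2 ≡ + k × k ℕ.< s → ∃[ l ] w /ℕ 2 ≡ + l × l ℕ.< s →
      (1ℤ - + s + u /ℕ 2 + w /ℕ 2 + + (u %ℕ 2) ≡ x × u /ℕ 2 - w /ℕ 2 ≡ y) → (x , y) ∈ window s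
    listed (k , e , k<s) (l , e′ , l<s) (ex , ey) = subst (_∈ window s)
      (cong₂ _,_ (trans (cong₂ (λ a b → 1ℤ - + s + a + b + + (u %ℕ 2)) (sym e) (sym e′)) ex)
        (trans (cong₂ _-_ (sym e) (sym e′)) ey))
      (∈-map⁺ (cell s) (∈-cartesianProduct⁺ (∈-cartesianProduct⁺ (∈-upTo⁺ k<s) (∈-upTo⁺ l<s)) (∈-upTo⁺ (n%ℕd<d u 2))))

  -- The unfolded broadcast and the final count.

  module Unfolding (m n s : ℕ) (m≢0 : m ≢ 0) (n≢0 : n ≢ 0) (2≤s : 2 ℕ.≤ s)
    (d : GridV m n → GridV m n → ℕ) (isDist : IsGridDist d)
    (Ts : List (GridV m n)) (unique : Unique Ts) (broadcast : IsBroadcast d (suc s) 2 Ts) where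

    IsCopy : Vector → GridV m n → Set
    IsCopy (x , y) (a , b) = Copy m x (toℕ a) × Copy n y (toℕ b)

    is-copy? : ∀ v T → Dec (IsCopy v T)
    is-copy? (x , y) (a , b) = copy? m x (toℕ a) ×-dec copy? n y (toℕ b)

    Tower : View
    Tower v = Any (IsCopy v) Ts

    tower? : ∀ v → Dec (Tower v)
    tower? v = any? (is-copy? v) Ts

    tower-periodic : ∀ k l x y → Tower (x , y) → Tower (x + k * + (2 ℕ.* m) , y + l * + (2 ℕ.* n))
    tower-periodic k l x y t = let (T , T∈ , c , c′) = find {P = IsCopy (x , y)} t in
      lose {P = IsCopy (x + k * + (2 ℕ.* m) , y + l * + (2 ℕ.* n))} T∈
        (copy-periodic m k x (toℕ (proj₁ T)) c , copy-periodic n l y (toℕ (proj₂ T)) c′)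

    module _ (x y : ℤ) where
      private
        module X = Unfolded (unfold m x m≢0)
        module Y = Unfolded (unfold n y n≢0)

        v : GridV m n
        v = X.base , Y.base

        lifted : GridV m n → Vector
        lifted (a , b) = X.lift (toℕ a) , Y.lift (toℕ b)

        lifted-tower : ∀ {T} → T ∈ Ts → Tower (lifted T)
        lifted-tower {T} p = lose {P = IsCopy (lifted T)} p (X.is-copy (toℕ (proj₁ T)) , Y.is-copy (toℕ (proj₂ T)))

        lifted-injective : ∀ {T T′} → lifted T ≡ lifted T′ → T ≡ T′
        lifted-injective e = cong₂ _,_ (Finₚ.toℕ-injective (X.injective (cong proj₁ e)))
            (Finₚ.toℕ-injective (Y.injective (cong proj₂ e)))

        -- Variables 5 to 8 are grid coordinates of a tower and of the vertex, 9 and 10 bound their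
        -- gaps. Lifting keeps each coordinate difference up to sign, so an ℓ¹ bound in the grid
        -- becomes a ball in the plane.
        box : Formula
        box = (var 1 ⊝ var 3 ≐ var 5 ⊝ var 6 ∨′ var 1 ⊝ var 3 ≐ var 6 ⊝ var 5) ⇒′
              (var 2 ⊝ var 4 ≐ var 7 ⊝ var 8 ∨′ var 2 ⊝ var 4 ≐ var 8 ⊝ var 7) ⇒′
              var 5 ≼ var 6 ⊕ var 9 ⇒′ var 6 ≼ var 5 ⊕ var 9 ⇒′ var 7 ≼ var 8 ⊕ var 10 ⇒′ var 8 ≼ var 7 ⊕ var 10 ⇒′
              var 9 ⊕ var 10 ≼ var 0 ⇒′ ball (var 0) (var 1 ⊝ var 3 , var 2 ⊝ var 4)

        close : ∀ r T → + (ℓ¹ T v) ≤ r →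
          ⟦ ball (var 0) (var 1 ⊝ var 3 , var 2 ⊝ var 4) ⟧ (env (r ∷ proj₁ (lifted T) ∷ proj₂ (lifted T) ∷ x ∷ y ∷ []))
        close r (a , b) h = by box
          (r ∷ X.lift (toℕ a) ∷ Y.lift (toℕ b) ∷ x ∷ y ∷ + toℕ a ∷ + toℕ X.base ∷ + toℕ b ∷ + toℕ Y.base ∷
            + gap (toℕ a) (toℕ X.base) ∷ + gap (toℕ b) (toℕ Y.base) ∷ [])
          (X.distance (toℕ a)) (Y.distance (toℕ b))
          (+≤+ (ℕₚ.m≤n+∣m-n∣ (toℕ a) (toℕ X.base))) (+≤+ (ℕₚ.m≤n+∣n-m∣ (toℕ X.base) (toℕ a)))
          (+≤+ (ℕₚ.m≤n+∣m-n∣ (toℕ b) (toℕ Y.base))) (+≤+ (ℕₚ.m≤n+∣n-m∣ (toℕ Y.base) (toℕ b))) h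

        reach : ∀ T k → suc k ℕ.≤ sig d (suc s) T v → ℓ¹ T v ℕ.+ k ℕ.≤ s
        reach T k h = ℕₚ.≤-pred (begin
            suc (ℓ¹ T v ℕ.+ k)   ≡⟨ ℕₚ.+-suc _ k ⟨
            ℓ¹ T v ℕ.+ suc k     ≤⟨ ℕₚ.+-mono-≤ (walk-ℓ¹ (proj₁ (isDist T v))) h ⟩
            d T v ℕ.+ (suc s ∸ d T v) ≡⟨ ℕₚ.m+[n∸m]≡n {d T v} {suc s} (ℕₚ.<⇒≤ (ℕₚ.m∸n≢0⇒n<m {suc s} {d T v} (λ e →
                ℕₚ.<⇒≢ (ℕₚ.≤-trans (s≤s z≤n) h) (sym e)))) ⟩
            suc s ∎)
          where
          open ℕₚ.≤-Reasoning

      supplied : Supplied (+ s) Tower (x , y)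
      supplied = [ (λ (T , p , h) →
          inj₁ (proj₁ (lifted T) , proj₂ (lifted T) , lifted-tower {T} p , close (+ s - 1ℤ) T (within-1 (ℓ¹ T v)
          (reach T 1 h))))
                 , (λ (T , T′ , p , p′ , T≢T′ , h , h′) → inj₂ (proj₁ (lifted T) , proj₂ (lifted T) ,
                     proj₁ (lifted T′) , proj₂ (lifted T′) , lifted-tower {T} p , lifted-tower {T′} p′ ,
                     (λ (e , e′) → T≢T′ (lifted-injective {T} {T′} (cong₂ _,_ e e′))) ,
                     close (+ s) T (within-0 (ℓ¹ T v) (reach T 0 h)) , close (+ s) T′ (within-0 (ℓ¹ T′ v)
                         (reach T′ 0 h′)))) ]′
        (two-signals d (suc s) v unique (broadcast v))
        where
        within-0 : ∀ l → l ℕ.+ 0 ℕ.≤ s → + l ≤ + s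
        within-0 l h = +≤+ (subst (ℕ._≤ s) (ℕₚ.+-identityʳ l) h)
        within-1 : ∀ l → l ℕ.+ 1 ℕ.≤ s → + l ≤ + s - 1ℤ
        within-1 l h = by (var 1 ⊕ lit 1ℤ ≼ var 0 ⇒′ var 1 ≼ var 0 ⊝ lit 1ℤ) (+ s ∷ + l ∷ []) (+≤+ h)

    nonzero : ∀ k → k ≢ 0 → ℕ.NonZero (2 ℕ.* k)
    nonzero k k≢0 = ℕₚ.m*n≢0 2 k {{_}} {{ℕ.≢-nonZero k≢0}}

    open Torus (+≤+ 2≤s) tower? (λ (x , y) → supplied x y) (2 ℕ.* m) (2 ℕ.* n) {{nonzero m m≢0}} {{nonzero n n≢0}}
      tower-periodic (window s) (window-complete s)

    -- At most two copies of each coordinate per period make 2 · 2 copies of a tower.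
    tower-count≤ : tower-count ℕ.≤ length Ts ℕ.* 4
    tower-count≤ = begin
        tower-count
          ≤⟨ total-mono bound ⟩
        total (λ v → ∑ Ts (λ T → hits v T))
          ≡⟨ total-∑ Ts (λ T v → hits v T) ⟩
        ∑ Ts (λ T → total (λ v → hits v T))
          ≤⟨ ∑-const-≤ Ts _ 4 four ⟩
        length Ts ℕ.* 4 ∎
      where
      open ℕₚ.≤-Reasoning
      hits : Vector → GridV m n → ℕ
      hits (x , y) (a , b) = indicator (copy? m x (toℕ a)) ℕ.* indicator (copy? n y (toℕ b))
      bound : ∀ v → indicator (tower? v) ℕ.≤ ∑ Ts (hits v)
      bound v = hit (tower? v)
        where
        hit : (t : Dec (Tower v)) → indicator t ℕ.≤ ∑ Ts (hits v)
        hit (no _) = z≤n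
        hit (yes t) = let (T , T∈ , c , c′) = find {P = IsCopy v} t in subst (ℕ._≤ ∑ Ts (hits v))
          (cong₂ ℕ._*_ (indicator-yes (copy? m (proj₁ v) (toℕ (proj₁ T))) c) (indicator-yes (copy? n (proj₂ v)
              (toℕ (proj₂ T))) c′)) (∑-one (hits v) T∈)
      four : ∀ T → total (λ v → hits v T) ℕ.≤ 4
      four (a , b) = begin
        total (λ v → hits v (a , b))
          ≡⟨ ∑<-cong (2 ℕ.* m) (λ i → ∑<-* (2 ℕ.* n) (indicator (copy? m (+ i) (toℕ a))) _) ⟩
        ∑< (2 ℕ.* m) (λ i → indicator (copy? m (+ i) (toℕ a)) ℕ.* column)
          ≡⟨ ∑<-cong (2 ℕ.* m) (λ i → ℕₚ.*-comm (indicator (copy? m (+ i) (toℕ a))) column) ⟩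
        ∑< (2 ℕ.* m) (λ i → column ℕ.* indicator (copy? m (+ i) (toℕ a)))
          ≡⟨ ∑<-* (2 ℕ.* m) column _ ⟩
        column ℕ.* cycle (2 ℕ.* m) (λ x → indicator (copy? m x (toℕ a)))
          ≤⟨ ℕₚ.*-mono-≤ (copies n n≢0 (toℕ b)) (copies m m≢0 (toℕ a)) ⟩
        4 ∎
        where
        column : ℕ
        column = cycle (2 ℕ.* n) (λ y → indicator (copy? n y (toℕ b)))

    bound : m ℕ.* n ℕ.≤ 2 ℕ.* s ^ 2 ℕ.* length Ts
    -- A period has area 4mn and at most four copies of each tower, so the factor 4 cancels.
    bound = ℕₚ.*-cancelˡ-≤ 4 (begin
        4 ℕ.* (m ℕ.* n)
          ≡⟨ solve 2 (λ m n → con 4 :* (m :* n) := (con 2 :* m) :* (con 2 :* n)) refl m n ⟩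
        2 ℕ.* m ℕ.* (2 ℕ.* n)
          ≤⟨ area≤ ⟩
        length (window s) ℕ.* tower-count
          ≤⟨ ℕₚ.*-monoʳ-≤ (length (window s)) tower-count≤ ⟩
        length (window s) ℕ.* (length Ts ℕ.* 4)
          ≡⟨ cong (ℕ._* (length Ts ℕ.* 4)) (length-window s) ⟩
        s ℕ.* s ℕ.* 2 ℕ.* (length Ts ℕ.* 4)
          ≡⟨ solve 2 (λ s k → s :* s :* con 2 :* (k :* con 4) := con 4 :* (con 2 :* (s :* (s :* con 1)) :* k)) refl s (length Ts) ⟩
        4 ℕ.* (2 ℕ.* s ^ 2 ℕ.* length Ts) ∎)
      where
      open ℕₚ.≤-Reasoning
      open ℕ-Solver

open import Data.Nat using (ℕ; _*_; _∸_; _^_; _≤_; _<_)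
open import Data.Nat using (suc; s≤s)
open import Data.List using (List; length)
open import Data.List.Relation.Unary.Unique.Propositional using (Unique)

theorem2 : ∀ (m n t : ℕ) → 1 ≤ m → 1 ≤ n → 2 < t →
    (d : GridV m n → GridV m n → ℕ) → IsGridDist d →
    (Ts : List (GridV m n)) → Unique Ts → IsBroadcast d t 2 Ts →
    m * n ≤ 2 * (t ∸ 1) ^ 2 * length Ts
theorem2 (suc m) (suc n) (suc s) _ _ (s≤s 2≤s) d isDist Ts unique broadcast =
  Unfold.Unfolding.bound (suc m) (suc n) s (λ ()) (λ ()) 2≤s d isDist Ts unique broadcast
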